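{- For $w\in\mathfrak{h}_C^0$ and $m\geq1$, \[ \sum_{i=1}^{m}(-1)^{i-1}F(y^{i-1}\,\underline{\ast}\, w,\,m-i)=\partial_{m}(w), \] where for $v\in\mathfrak{h}_C^0$ and $n\ge0$, $F(v,n):=\{1\}_{\star}^{n}\,\underline{\ast}\,(y\,\underline{\sqcup\!\sqcup}\, v)-(n+1)\{1\}_{\star}^{n+1}\,\underline{\ast}\, v$.
   Context: $\mathfrak{h}=\mathbb{Q}\langle x,y\rangle$, $\mathfrak{h}_C=\mathfrak{h}x\oplus\mathfrak{h}y$, $\mathfrak{h}^0=\mathbb{Q}\oplus y\mathfrak{h}x$, $\mathfrak{h}^1=\mathbb{Q}\oplus y\mathfrak{h}$, $\mathfrak{h}_C^0=\mathfrak{h}^0\cap\mathfrak{h}_C$, $\mathfrak{h}_C^1=\mathfrak{h}^1\cap\mathfrak{h}_C$, $z_k=yx^{k-1}$, $y^0=1$. $\{1\}_\star^0:=1$ and $\{1\}_\star^n:=y(x+y)^{n-1}$ for $n>0$. $\partial_m$ is the derivation of $\mathfrak{h}$ with $\partial_{m}(x)=y(x+y)^{m-1}x$, $\partial_{m}(y)=-y(x+y)^{m-1}x$. Shuffle: bilinear on $\mathfrak{h}$ with $1\sqcup\!\sqcup w=w\sqcup\!\sqcup 1=w$, $uw\sqcup\!\sqcup u'w'=u(w\sqcup\!\sqcup u'w')+u'(uw\sqcup\!\sqcup w')$ ($u,u'\in\{x,y\}$). Inner shuffle $\underline{\sqcup\!\sqcup}:\mathfrak{h}\times\mathfrak{h}_C\to\mathfrak{h}_C$: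 bilinear with $w\,\underline{\sqcup\!\sqcup}\,x=w\,\underline{\sqcup\!\sqcup}\,y=0$, $w\,\underline{\sqcup\!\sqcup}\, uw'u'=u(w\sqcup\!\sqcup w')u'$ ($u,u'\in\{x,y\}$). Inner harmonic product $\underline{\ast}:\mathfrak{h}^1\times\mathfrak{h}_C^1\to\mathfrak{h}_C^1$: bilinear, with $1\,\underline{\ast}\,w=w$ and on words ($s\ge1$) $z_{k_{1}}\cdots z_{k_{r}}\,\underline{\ast}\, z_{l_{1}}\cdots z_{l_{s}}=\sum_{d=\max(r,s)}^{r+s}\sum_{(f,g)}z_{m_{1}}\cdots z_{m_{d}}$, over strictly increasing $f:\{1,\dots,r\}\to\{1,\dots,d\}$, $g:\{1,\dots,s\}\to\{1,\dots,d\}$ with $\mathrm{Im}f\cup\mathrm{Im}g=\{1,\dots,d\}$ and $g(1)\le f(i)\le g(s)$ for all $i$, where $m_i=k_{f^{ -1}(i)}$ on $\mathrm{Im}f\setminus\mathrm{Im}g$, $m_i=l_{g^{ -1}(i)}$ on $\mathrm{Im}g\setminus\mathrm{Im}f$, $m_i=k_{f^{ -1}(i)}+l_{g^{ -1}(i)}$ on $\mathrm{Im}f\cap\mathrm{Im}g$. -}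

module Defs where

open import Data.Nat using (ℕ; zero; suc; _≤_; _≤ᵇ_)
open import Data.Bool using (Bool; true; false; _∧_; if_then_else_)
open import Data.List using (List; []; _∷_; _++_; map; concatMap; foldr; replicate)
open import Data.Maybe using (Maybe; just; nothing)
open import Data.Product using (_×_; _,_; Σ; ∃)
open import Data.Integer using (+_)
open import Data.Rational using (ℚ; 0ℚ; 1ℚ; _+_; _*_; -_; _/_)
open import Relation.Binary.PropositionalEquality using (_≡_; _≢_; refl; cong₂)
open import Relation.Nullary using (Dec; yes; no)

data Letter : Set where
  x y : Letter

Word : Set
Word = List Letter

_≟L_ : (a b : Letter) → Dec (a ≡ b)
x ≟L x = yes refl
x ≟L y = no (λ ())
y ≟L x = no (λ ())
y ≟L y = yes refl

_≟W_ : (u v : Word) → Dec (u ≡ v)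
[] ≟W [] = yes refl
[] ≟W (_ ∷ _) = no (λ ())
(_ ∷ _) ≟W [] = no (λ ())
(a ∷ u) ≟W (b ∷ v) with a ≟L b | u ≟W v
... | yes refl | yes refl = yes refl
... | no a≢b | _ = no (λ { refl → a≢b refl })
... | yes _ | no u≢v = no (λ { refl → u≢v refl })

-- Elements of 𝔥: finite formal ℚ-linear combinations of words.
-- Two representations denote the same element iff all coefficients agree.

Poly : Set
Poly = List (ℚ × Word)

coeff : Poly → Word → ℚ
coeff [] w = 0ℚ
coeff ((a , u) ∷ p) w with u ≟W w
... | yes _ = a + coeff p w
... | no _  = coeff p w

infix 4 _≈_
_≈_ : Poly → Poly → Set
p ≈ q = ∀ w → coeff p w ≡ coeff q w

zeroP : Poly
zeroP = []

mon : Word → Poly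
mon w = (1ℚ , w) ∷ []

infixl 6 _⊕_ _⊖_
_⊕_ : Poly → Poly → Poly
p ⊕ q = p ++ q

scale : ℚ → Poly → Poly
scale c p = map (λ { (a , u) → (c * a , u) }) p

_⊖_ : Poly → Poly → Poly
p ⊖ q = p ⊕ scale (- 1ℚ) q

bilin : (Word → Word → Poly) → Poly → Poly → Poly
bilin f p q = concatMap (λ { (a , u) → concatMap (λ { (b , v) → scale (a * b) (f u v) }) q }) p

lin : (Word → Poly) → Poly → Poly
lin f p = concatMap (λ { (a , u) → scale a (f u) }) p

infixl 7 _·_
_·_ : Poly → Poly → Poly
_·_ = bilin (λ u v → mon (u ++ v))

ℕ→ℚ : ℕ → ℚ
ℕ→ℚ n = (+ n) / 1

sgn : ℕ → ℚ
sgn zero = 1ℚ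
sgn (suc n) = - sgn n

sumP : (m : ℕ) → (ℕ → Poly) → Poly
sumP zero f = zeroP
sumP (suc m) f = sumP m f ⊕ f (suc m)

-- 𝔥_C^0 = 𝔥^0 ∩ 𝔥_C = y𝔥x : every word with nonzero coefficient is y u x
InHC0 : Poly → Set
InHC0 w = ∀ u → coeff w u ≢ 0ℚ → Σ Word (λ v → u ≡ y ∷ (v ++ (x ∷ [])))

allWords : ℕ → List Word
allWords zero = [] ∷ []
allWords (suc n) = concatMap (λ w → (x ∷ w) ∷ (y ∷ w) ∷ []) (allWords n)

xpy^ : ℕ → Poly
xpy^ n = map (λ w → (1ℚ , w)) (allWords n)

one⋆ : ℕ → Poly
one⋆ zero = mon []
one⋆ (suc n) = mon (y ∷ []) · xpy^ n

yPow : ℕ → Poly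
yPow n = mon (replicate n y)

shW : Word → Word → Poly
shW [] v = mon v
shW (a ∷ u) [] = mon (a ∷ u)
shW (a ∷ u) (b ∷ v) = map (λ { (c , w) → (c , a ∷ w) }) (shW u (b ∷ v))
                   ++ map (λ { (c , w) → (c , b ∷ w) }) (shWa a u v)
  where
  shWa : Letter → Word → Word → Poly
  shWa a u [] = mon (a ∷ u)
  shWa a u (b' ∷ v') = map (λ { (c , w) → (c , a ∷ w) }) (shW u (b' ∷ v'))
                     ++ map (λ { (c , w) → (c , b' ∷ w) }) (shWa a u v')

infixl 7 _⧢_
_⧢_ : Poly → Poly → Poly
_⧢_ = bilin shW

initLast : Word → Maybe (Word × Letter)
initLast [] = nothing
initLast (a ∷ []) = just ([] , a)
initLast (a ∷ b ∷ w) with initLast (b ∷ w)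
... | just (i , l) = just (a ∷ i , l)
... | nothing = nothing

innerShW : Word → Word → Poly
innerShW w [] = zeroP            -- outside 𝔥_C
innerShW w (a ∷ rest) with initLast rest
... | nothing = zeroP            -- w ⧢̲ x = w ⧢̲ y = 0
... | just (w' , a') = map (λ { (c , v) → (c , a ∷ (v ++ (a' ∷ []))) }) (shW w w')

infixl 7 _⧢̲_
_⧢̲_ : Poly → Poly → Poly
_⧢̲_ = bilin innerShW

z : ℕ → Word
z k = y ∷ replicate (Data.Nat.pred k) x

zWord : List ℕ → Word
zWord ks = concatMap z ks

toZgo : ℕ → Word → List ℕ
toZgo k [] = k ∷ []
toZgo k (x ∷ w) = toZgo (suc k) w
toZgo k (y ∷ w) = k ∷ toZgo 1 w

toZ : Word → Maybe (List ℕ)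
toZ [] = just []
toZ (x ∷ _) = nothing
toZ (y ∷ w) = just (toZgo 1 w)

-- A pair (f , g) as in the definition is encoded by the list of labels of
-- positions 1..d:  F (in Im f only), G (in Im g only), B (in both).
data Label : Set where
  F G B : Label

pats : ℕ → ℕ → List (List Label)
pats zero zero = [] ∷ []
pats (suc r) zero = map (F ∷_) (pats r zero)
pats zero (suc s) = map (G ∷_) (pats zero s)
pats (suc r) (suc s) = map (F ∷_) (pats r (suc s))
                    ++ map (G ∷_) (pats (suc r) s)
                    ++ map (B ∷_) (pats r s)

applyPat : List Label → List ℕ → List ℕ → List ℕ
applyPat [] _ _ = []
applyPat (F ∷ p) (k ∷ ks) ls = k ∷ applyPat p ks ls
applyPat (G ∷ p) ks (l ∷ ls) = l ∷ applyPat p ks ls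
applyPat (B ∷ p) (k ∷ ks) (l ∷ ls) = (k Data.Nat.+ l) ∷ applyPat p ks ls
applyPat _ _ _ = []   -- not reached for patterns from pats

imF : ℕ → List Label → List ℕ
imF i [] = []
imF i (F ∷ p) = i ∷ imF (suc i) p
imF i (G ∷ p) = imF (suc i) p
imF i (B ∷ p) = i ∷ imF (suc i) p

imG : ℕ → List Label → List ℕ
imG i [] = []
imG i (F ∷ p) = imG (suc i) p
imG i (G ∷ p) = i ∷ imG (suc i) p
imG i (B ∷ p) = i ∷ imG (suc i) p

headN : List ℕ → ℕ
headN [] = 0
headN (n ∷ _) = n

lastN : List ℕ → ℕ
lastN [] = 0
lastN (n ∷ []) = n
lastN (_ ∷ m ∷ ns) = lastN (m ∷ ns)

allB : (ℕ → Bool) → List ℕ → Bool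
allB P [] = true
allB P (n ∷ ns) = P n ∧ allB P ns

-- condition  g(1) ≤ f(i) ≤ g(s)  for all i
admissible : List Label → Bool
admissible p = allB (λ j → (headN (imG 1 p) ≤ᵇ j) ∧ (j ≤ᵇ lastN (imG 1 p))) (imF 1 p)

filterB : {A : Set} → (A → Bool) → List A → List A
filterB P [] = []
filterB P (a ∷ as) = if P a then a ∷ filterB P as else filterB P as

lengthN : {A : Set} → List A → ℕ
lengthN [] = 0
lengthN (_ ∷ as) = suc (lengthN as)

harmZ : List ℕ → List ℕ → Poly
harmZ ks ls =
  map (λ p → (1ℚ , zWord (applyPat p ks ls)))
      (filterB admissible (pats (lengthN ks) (lengthN ls)))

innerHarmW : Word → Word → Poly
innerHarmW [] w = mon w
innerHarmW (a ∷ u) w with toZ (a ∷ u) | toZ w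
... | just ks | just (l ∷ ls) = harmZ ks (l ∷ ls)
... | _ | _ = zeroP                          -- outside 𝔥^1 × 𝔥_C^1

infixl 7 _∗̲_
_∗̲_ : Poly → Poly → Poly
_∗̲_ = bilin innerHarmW

∂img : ℕ → Letter → Poly
∂img m x = mon (y ∷ []) · xpy^ (Data.Nat.pred m) · mon (x ∷ [])
∂img m y = scale (- 1ℚ) (mon (y ∷ []) · xpy^ (Data.Nat.pred m) · mon (x ∷ []))

∂W : ℕ → Word → Poly
∂W m [] = zeroP
∂W m (a ∷ w) = (∂img m a · mon w) ⊕ (mon (a ∷ []) · ∂W m w)

∂ : ℕ → Poly → Poly
∂ m = lin (∂W m)

Fv : Poly → ℕ → Poly
Fv v n = (one⋆ n ∗̲ (mon (y ∷ []) ⧢̲ v)) ⊖ scale (ℕ→ℚ (suc n)) (one⋆ (suc n) ∗̲ v)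

LHS : ℕ → Poly → Poly
LHS m w = sumP m (λ i → scale (sgn (Data.Nat.pred i)) (Fv (yPow (Data.Nat.pred i) ∗̲ w) (m Data.Nat.∸ i)))

{-# OPTIONS --safe #-}
-- Let A = Σₙ tⁿ ({1}⋆ⁿ ∗̲ _), B = Σₙ (-t)ⁿ (yⁿ ∗̲ _), D = y ⧢̲ _ and ∂ₜ = Σₘ tᵐ⁻¹ ∂ₘ. The generating
-- series of the left-hand sides is (A D - A′) B, where ′ is d/dt. With P = (1 - t(x+y))⁻¹ and ψ the
-- endomorphism x ↦ x, y ↦ P y one has A w = P⁻¹ ψ(w) (1 - t x)⁻¹ for w ∈ y𝔥, and D inserts a y into
-- every inner gap of a word. Comparing the ψ-derivations involved letter by letter gives
-- A D - A′ = ∂ₜ A, and A B = 1, whence (A D - A′) B = ∂ₜ.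
module Submission where

open import Defs
open import Data.Nat using (ℕ; _≥_)
open import Data.Nat using (zero; suc; pred; _≤_; _<_; z≤n; s≤s; _∸_; _≤ᵇ_)
import Data.Nat as ℕ
import Data.Nat.Properties as ℕ
open import Data.Nat.GeneralisedArithmetic using (fold)
import Data.Integer as ℤ
import Data.Integer.Properties as ℤ
open import Data.Fin using (Fin; #_)
open import Data.List using (List; []; _∷_; _++_; map; concatMap; length)
import Data.List as List
open import Data.List.Properties using (map-∘; map-++)
open import Data.List.Relation.Unary.All as All using (All; []; _∷_)
import Data.List.Relation.Unary.All.Properties as All
open import Data.Bool using (Bool; true; false; _∧_)
open import Data.Maybe using (just; nothing)
open import Data.Product using (_×_; _,_; ∃₂)
open import Data.Rational using (ℚ; 0ℚ; 1ℚ; _+_; _*_; -_; toℚᵘ)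
import Data.Rational.Properties as ℚ
open import Data.Rational.Unnormalised using (mkℚᵘ; *≡*)
import Data.Rational.Unnormalised.Properties as ℚᵘ
open import Data.Rational.Solver using (module +-*-Solver)
open import Data.Vec using (Vec; []; _∷_; lookup; replicate; zipWith)
import Data.Vec as Vec
open import Level using (0ℓ)
open import Relation.Nullary.Decidable using (dec-true; dec-false)
open import Relation.Binary.Bundles using (Setoid)
import Relation.Binary.Reasoning.Setoid as SetoidReasoning
open import Relation.Binary.PropositionalEquality
open import Relation.Nullary using (yes; no; contradiction)

-- The obstacle is that the inner harmonic product works block by block on the `z k`, whereas D and
-- ∂ₘ work letter by letter. The translation succeeds because {1}⋆ⁿ is the sum over all compositions
-- of n: letting the size of a part vary, whether it stands alone or is merged into a block of the
-- word, produces geometric series in x, and these combine to P. The condition g(1) ≤ f(i) makes the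
-- first block of the word the first block of every term, possibly lengthened, so that the initial y
-- can be split off and only the rest w is followed. The condition f(i) ≤ g(s) lets parts reach the
-- end only by merging into the last block, whence the right factor (1 - t x)⁻¹. Splitting off y has
-- a price: ∂ₜ y = - y P x leaves a correction term, which is kept on the side where its sign is
-- positive. Polynomials are lists with possible repetitions, not a quotient, so each operator must
-- be shown to depend on coefficients only.

-- Linear combinations of words

-- Unlike the function type _≈_, a record lets Agda infer p and q.
infix 4 _≋_
record _≋_ (p q : Poly) : Set where
  constructor mk≋
  field at : p ≈ q

open _≋_

≋-refl : ∀ {p} → p ≋ p
≋-refl = mk≋ λ _ → refl

≋-reflexive : ∀ {p q} → p ≡ q → p ≋ q
≋-reflexive refl = ≋-refl

≋-sym : ∀ {p q} → p ≋ q → q ≋ p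
≋-sym e = mk≋ λ w → sym (at e w)

≋-trans : ∀ {p q r} → p ≋ q → q ≋ r → p ≋ r
≋-trans e f = mk≋ λ w → trans (at e w) (at f w)

≋-setoid : Setoid 0ℓ 0ℓ
≋-setoid = record
  { Carrier = Poly
  ; _≈_ = _≋_
  ; isEquivalence = record { refl = ≋-refl ; sym = ≋-sym ; trans = ≋-trans }
  }

open SetoidReasoning ≋-setoid

coeff-⊕ : ∀ p q w → coeff (p ⊕ q) w ≡ coeff p w + coeff q w
coeff-⊕ [] q w = sym (ℚ.+-identityˡ _)
coeff-⊕ ((a , u) ∷ p) q w with u ≟W w
... | yes _ = trans (cong (a +_) (coeff-⊕ p q w)) (sym (ℚ.+-assoc a _ _))
... | no _ = coeff-⊕ p q w

coeff-scale : ∀ c p w → coeff (scale c p) w ≡ c * coeff p w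
coeff-scale c [] w = sym (ℚ.*-zeroʳ c)
coeff-scale c ((a , u) ∷ p) w with u ≟W w
... | yes _ = trans (cong (c * a +_) (coeff-scale c p w)) (sym (ℚ.*-distribˡ-+ c a _))
... | no _ = coeff-scale c p w

⊕-cong : ∀ {p p′ q q′} → p ≋ p′ → q ≋ q′ → p ⊕ q ≋ p′ ⊕ q′
⊕-cong {p} {p′} {q} {q′} e f = mk≋ λ w →
  trans (coeff-⊕ p q w) (trans (cong₂ _+_ (at e w) (at f w)) (sym (coeff-⊕ p′ q′ w)))

⊕-congˡ : ∀ p {q q′} → q ≋ q′ → p ⊕ q ≋ p ⊕ q′
⊕-congˡ p = ⊕-cong (≋-refl {p})

⊕-congʳ : ∀ {p p′} q → p ≋ p′ → p ⊕ q ≋ p′ ⊕ q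
⊕-congʳ q e = ⊕-cong e (≋-refl {q})

scale-cong : ∀ c {p q} → p ≋ q → scale c p ≋ scale c q
scale-cong c {p} {q} e = mk≋ λ w →
  trans (coeff-scale c p w) (trans (cong (c *_) (at e w)) (sym (coeff-scale c q w)))

scale-⊕ : ∀ c p q → scale c (p ⊕ q) ≋ scale c p ⊕ scale c q
scale-⊕ c p q = mk≋ λ w → trans (coeff-scale c (p ⊕ q) w)
  (trans (cong (c *_) (coeff-⊕ p q w)) (trans (ℚ.*-distribˡ-+ c _ _)
    (sym (trans (coeff-⊕ (scale c p) _ w) (cong₂ _+_ (coeff-scale c p w) (coeff-scale c q w))))))

scale-+ : ∀ c d p → scale (c + d) p ≋ scale c p ⊕ scale d p
scale-+ c d p = mk≋ λ w → trans (coeff-scale (c + d) p w)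
  (trans (ℚ.*-distribʳ-+ _ c d)
    (sym (trans (coeff-⊕ (scale c p) _ w) (cong₂ _+_ (coeff-scale c p w) (coeff-scale d p w)))))

scale-* : ∀ c d p → scale (c * d) p ≋ scale c (scale d p)
scale-* c d p = mk≋ λ w → trans (coeff-scale (c * d) p w)
  (trans (ℚ.*-assoc c d _)
    (sym (trans (coeff-scale c (scale d p) w) (cong (c *_) (coeff-scale d p w)))))

scale-1 : ∀ p → scale 1ℚ p ≋ p
scale-1 p = mk≋ λ w → trans (coeff-scale 1ℚ p w) (ℚ.*-identityˡ _)

scale-0 : ∀ p → scale 0ℚ p ≋ zeroP
scale-0 p = mk≋ λ w → trans (coeff-scale 0ℚ p w) (ℚ.*-zeroˡ (coeff p w))

scale-comm : ∀ c d p → scale c (scale d p) ≋ scale d (scale c p)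
scale-comm c d p = ≋-trans (≋-sym (scale-* c d p))
  (≋-trans (≋-reflexive (cong (λ e → scale e p) (ℚ.*-comm c d))) (scale-* d c p))

-- A decision procedure for additive identities

infixl 6 _:+_ _:-_
data Expr (n : ℕ) : Set where
  var : Fin n → Expr n
  :0 : Expr n
  _:+_ _:-_ : Expr n → Expr n → Expr n

v₀ : ∀ {n} → Expr (1 ℕ.+ n)
v₀ = var (# 0)

v₁ : ∀ {n} → Expr (2 ℕ.+ n)
v₁ = var (# 1)

v₂ : ∀ {n} → Expr (3 ℕ.+ n)
v₂ = var (# 2)

v₃ : ∀ {n} → Expr (4 ℕ.+ n)
v₃ = var (# 3)

module _ {n : ℕ} where

  ⟦_⟧ : Expr n → Vec Poly n → Poly
  ⟦ var i ⟧ ρ = lookup ρ i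
  ⟦ :0 ⟧ ρ = zeroP
  ⟦ e :+ f ⟧ ρ = ⟦ e ⟧ ρ ⊕ ⟦ f ⟧ ρ
  ⟦ e :- f ⟧ ρ = ⟦ e ⟧ ρ ⊖ ⟦ f ⟧ ρ

  normal : Expr n → Vec ℚ n
  normal (var i) = (replicate n 0ℚ) Vec.[ i ]≔ 1ℚ
  normal :0 = replicate n 0ℚ
  normal (e :+ f) = zipWith _+_ (normal e) (normal f)
  normal (e :- f) = zipWith (λ a b → a + (- 1ℚ) * b) (normal e) (normal f)

combination : ∀ {n} → Vec ℚ n → Vec Poly n → Word → ℚ
combination [] [] w = 0ℚ
combination (c ∷ cs) (p ∷ ρ) w = c * coeff p w + combination cs ρ w

combination-0 : ∀ {n} (ρ : Vec Poly n) w → combination (replicate n 0ℚ) ρ w ≡ 0ℚ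
combination-0 [] w = refl
combination-0 (p ∷ ρ) w = cong₂ _+_ (ℚ.*-zeroˡ (coeff p w)) (combination-0 ρ w)

combination-var : ∀ {n} i (ρ : Vec Poly n) w →
  combination ((replicate n 0ℚ) Vec.[ i ]≔ 1ℚ) ρ w ≡ coeff (lookup ρ i) w
combination-var Fin.zero (p ∷ ρ) w =
  trans (cong₂ _+_ (ℚ.*-identityˡ (coeff p w)) (combination-0 ρ w)) (ℚ.+-identityʳ _)
combination-var (Fin.suc i) (p ∷ ρ) w =
  trans (cong₂ _+_ (ℚ.*-zeroˡ (coeff p w)) (combination-var i ρ w)) (ℚ.+-identityˡ _)

combination-zipWith : ∀ {n} k (cs ds : Vec ℚ n) ρ w →
  combination (zipWith (λ a b → a + k * b) cs ds) ρ w ≡ combination cs ρ w + k * combination ds ρ w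
combination-zipWith k [] [] [] w = sym (trans (ℚ.+-identityˡ _) (ℚ.*-zeroʳ k))
combination-zipWith k (c ∷ cs) (d ∷ ds) (p ∷ ρ) w =
  trans (cong ((c + k * d) * coeff p w +_) (combination-zipWith k cs ds ρ w))
    (solve 6 (λ c d k p e f → (c :+′ k :*′ d) :*′ p :+′ (e :+′ k :*′ f) :=′ (c :*′ p :+′ e) :+′ k :*′ (d :*′ p :+′ f)) refl
       c d k (coeff p w) (combination cs ρ w) (combination ds ρ w))
  where open +-*-Solver renaming (_:+_ to _:+′_; _:*_ to _:*′_; _:=_ to _:=′_)

combination-+ : ∀ {n} (cs ds : Vec ℚ n) ρ w →
  combination (zipWith _+_ cs ds) ρ w ≡ combination cs ρ w + combination ds ρ w
combination-+ [] [] [] w = refl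
combination-+ (c ∷ cs) (d ∷ ds) (p ∷ ρ) w =
  trans (cong ((c + d) * coeff p w +_) (combination-+ cs ds ρ w))
    (solve 5 (λ c d p e f → (c :+′ d) :*′ p :+′ (e :+′ f) :=′ (c :*′ p :+′ e) :+′ (d :*′ p :+′ f)) refl
       c d (coeff p w) (combination cs ρ w) (combination ds ρ w))
  where open +-*-Solver renaming (_:+_ to _:+′_; _:*_ to _:*′_; _:=_ to _:=′_)

normal-correct : ∀ {n} (e : Expr n) ρ w → combination (normal e) ρ w ≡ coeff (⟦ e ⟧ ρ) w
normal-correct (var i) ρ w = combination-var i ρ w
normal-correct :0 ρ w = combination-0 ρ w
normal-correct (e :+ f) ρ w = trans (combination-+ (normal e) (normal f) ρ w)
  (trans (cong₂ _+_ (normal-correct e ρ w) (normal-correct f ρ w)) (sym (coeff-⊕ (⟦ e ⟧ ρ) _ w)))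
normal-correct (e :- f) ρ w = trans (combination-zipWith (- 1ℚ) (normal e) (normal f) ρ w)
  (trans (cong₂ (λ a b → a + (- 1ℚ) * b) (normal-correct e ρ w) (normal-correct f ρ w))
    (sym (trans (coeff-⊕ (⟦ e ⟧ ρ) _ w) (cong (coeff (⟦ e ⟧ ρ) w +_) (coeff-scale (- 1ℚ) (⟦ f ⟧ ρ) w)))))

-- `normal` yields a vector of closed rationals, so callers discharge the hypothesis by `refl`.
additively : ∀ {n} (ρ : Vec Poly n) (e f : Expr n) → normal e ≡ normal f → ⟦ e ⟧ ρ ≋ ⟦ f ⟧ ρ
additively ρ e f eq = mk≋ λ w →
  trans (sym (normal-correct e ρ w)) (trans (cong (λ cs → combination cs ρ w) eq) (normal-correct f ρ w))

⊕-comm : ∀ p q → p ⊕ q ≋ q ⊕ p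
⊕-comm p q = additively (p ∷ q ∷ []) (v₀ :+ v₁) (v₁ :+ v₀) refl

⊕-cancelʳ : ∀ {p q} r → p ⊕ r ≋ q ⊕ r → p ≋ q
⊕-cancelʳ {p} {q} r e = begin
  p ≈⟨ additively (p ∷ r ∷ []) (v₀ :+ v₁ :- v₁) v₀ refl ⟨
  p ⊕ r ⊖ r ≈⟨ ⊕-congʳ (scale (- 1ℚ) r) e ⟩
  q ⊕ r ⊖ r ≈⟨ additively (q ∷ r ∷ []) (v₀ :+ v₁ :- v₁) v₀ refl ⟩
  q ∎

⊕-interchange : ∀ p q r t → (p ⊕ q) ⊕ (r ⊕ t) ≋ (p ⊕ r) ⊕ (q ⊕ t)
⊕-interchange p q r t = additively (p ∷ q ∷ r ∷ t ∷ [])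
  ((v₀ :+ v₁) :+ (v₂ :+ v₃)) ((v₀ :+ v₂) :+ (v₁ :+ v₃)) refl

-- Linear maps

evaluate : (Word → ℚ) → Poly → ℚ
evaluate φ [] = 0ℚ
evaluate φ ((a , u) ∷ p) = a * φ u + evaluate φ p

evaluate-⊕ : ∀ φ p q → evaluate φ (p ⊕ q) ≡ evaluate φ p + evaluate φ q
evaluate-⊕ φ [] q = sym (ℚ.+-identityˡ _)
evaluate-⊕ φ ((a , u) ∷ p) q =
  trans (cong (a * φ u +_) (evaluate-⊕ φ p q)) (sym (ℚ.+-assoc (a * φ u) _ _))

evaluate-scale : ∀ φ c p → evaluate φ (scale c p) ≡ c * evaluate φ p
evaluate-scale φ c [] = sym (ℚ.*-zeroʳ c)
evaluate-scale φ c ((a , u) ∷ p) =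
  trans (cong₂ _+_ (ℚ.*-assoc c a (φ u)) (evaluate-scale φ c p)) (sym (ℚ.*-distribˡ-+ c _ _))

-- All occurrences go at once: a list may repeat a word, and only its total coefficient is known.
remove : Word → Poly → Poly
remove u [] = []
remove u ((a , v) ∷ p) with v ≟W u
... | yes _ = remove u p
... | no _ = (a , v) ∷ remove u p

length-remove : ∀ u p → length (remove u p) ≤ length p
length-remove u [] = z≤n
length-remove u ((a , v) ∷ p) with v ≟W u
... | yes _ = ℕ.m≤n⇒m≤1+n (length-remove u p)
... | no _ = s≤s (length-remove u p)

length-remove-head : ∀ a u p → length (remove u ((a , u) ∷ p)) ≤ length p
length-remove-head a u p with u ≟W u
... | yes _ = length-remove u p
... | no u≢u = contradiction refl u≢u

evaluate-remove : ∀ φ u p → evaluate φ p ≡ coeff p u * φ u + evaluate φ (remove u p)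
evaluate-remove φ u [] = sym (trans (ℚ.+-identityʳ _) (ℚ.*-zeroˡ (φ u)))
evaluate-remove φ u ((a , v) ∷ p) with v ≟W u
... | yes refl = trans (cong (a * φ v +_) (evaluate-remove φ v p))
  (trans (sym (ℚ.+-assoc (a * φ v) _ _)) (cong (_+ evaluate φ (remove v p)) (sym (ℚ.*-distribʳ-+ (φ v) a _))))
... | no _ = trans (cong (a * φ v +_) (evaluate-remove φ u p))
  (solve 3 (λ a b c → a :+′ (b :+′ c) :=′ b :+′ (a :+′ c)) refl (a * φ v) (coeff p u * φ u) (evaluate φ (remove u p)))
  where open +-*-Solver renaming (_:+_ to _:+′_; _:=_ to _:=′_)

coeff-remove-same : ∀ u p → coeff (remove u p) u ≡ 0ℚ
coeff-remove-same u [] = refl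
coeff-remove-same u ((a , v) ∷ p) with v ≟W u in eq
... | yes _ = coeff-remove-same u p
... | no _ rewrite eq = coeff-remove-same u p

coeff-remove-other : ∀ u p w → u ≢ w → coeff (remove u p) w ≡ coeff p w
coeff-remove-other u [] w u≢w = refl
coeff-remove-other u ((a , v) ∷ p) w u≢w with v ≟W u
coeff-remove-other u ((a , v) ∷ p) w u≢w | yes refl with v ≟W w
... | yes v≡w = contradiction v≡w u≢w
... | no _ = coeff-remove-other v p w u≢w
coeff-remove-other u ((a , v) ∷ p) w u≢w | no _ with v ≟W w
... | yes _ = cong (a +_) (coeff-remove-other u p w u≢w)
... | no _ = coeff-remove-other u p w u≢w

-- Removing the head word leaves a null combination that is shorter but not a structural sublist,
-- hence the induction on a bound for the length.
evaluate-null : ∀ φ n p → length p ≤ n → p ≈ zeroP → evaluate φ p ≡ 0ℚ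
evaluate-null φ n [] _ _ = refl
evaluate-null φ (suc n) r@((a , u) ∷ p) (s≤s p≤n) r≈0 =
  trans (evaluate-remove φ u r)
    (cong₂ _+_ (trans (cong (_* φ u) (r≈0 u)) (ℚ.*-zeroˡ (φ u)))
      (evaluate-null φ n (remove u r) (ℕ.≤-trans (length-remove-head a u p) p≤n) removed≈0))
  where
  removed≈0 : remove u r ≈ zeroP
  removed≈0 w with u ≟W w
  ... | yes refl = coeff-remove-same u r
  ... | no u≢w = trans (coeff-remove-other u r w u≢w) (r≈0 w)

evaluate-cong : ∀ φ {p q} → p ≋ q → evaluate φ p ≡ evaluate φ q
evaluate-cong φ {p} {q} e = ℚ-difference _ _
  (trans (sym (trans (evaluate-⊕ φ p _) (cong (_+_ (evaluate φ p)) (evaluate-scale φ (- 1ℚ) q))))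
    (evaluate-null φ _ (p ⊖ q) ℕ.≤-refl (at p⊖q≋0)))
  where
  p⊖q≋0 : p ⊖ q ≋ zeroP
  p⊖q≋0 = ≋-trans (⊕-congʳ (scale (- 1ℚ) q) e) (additively (q ∷ []) (v₀ :- v₀) :0 refl)
  ℚ-difference : ∀ a b → a + (- 1ℚ) * b ≡ 0ℚ → a ≡ b
  ℚ-difference a b eq = trans (solve 2 (λ a b → a :=′ (a :+′ (:-′ con 1ℚ) :*′ b) :+′ b) refl a b)
    (trans (cong (_+ b) eq) (ℚ.+-identityˡ b))
    where open +-*-Solver renaming (_:+_ to _:+′_; _:*_ to _:*′_; _:=_ to _:=′_; :-_ to :-′_)

coeff-lin : ∀ f p w → coeff (lin f p) w ≡ evaluate (λ u → coeff (f u) w) p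
coeff-lin f [] w = refl
coeff-lin f ((a , u) ∷ p) w = trans (coeff-⊕ (scale a (f u)) _ w)
  (cong₂ _+_ (coeff-scale a (f u) w) (coeff-lin f p w))

record Linear (L : Poly → Poly) : Set where
  field
    cong-≋ : ∀ {p q} → p ≋ q → L p ≋ L q
    ⊕-homo : ∀ p q → L (p ⊕ q) ≋ L p ⊕ L q
    scale-homo : ∀ c p → L (scale c p) ≋ scale c (L p)

  zero-homo : L zeroP ≋ zeroP
  zero-homo = ≋-trans (scale-homo 0ℚ zeroP) (scale-0 (L zeroP))

  ⊖-homo : ∀ p q → L (p ⊖ q) ≋ L p ⊖ L q
  ⊖-homo p q = ≋-trans (⊕-homo p _) (⊕-congˡ (L p) (scale-homo (- 1ℚ) q))

open Linear

linear-lin : ∀ f → Linear (lin f)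
linear-lin f .cong-≋ {p} {q} e = mk≋ λ w →
  trans (coeff-lin f p w) (trans (evaluate-cong _ e) (sym (coeff-lin f q w)))
linear-lin f .⊕-homo p q = mk≋ λ w →
  trans (coeff-lin f (p ⊕ q) w) (trans (evaluate-⊕ _ p q)
    (sym (trans (coeff-⊕ (lin f p) _ w) (cong₂ _+_ (coeff-lin f p w) (coeff-lin f q w)))))
linear-lin f .scale-homo c p = mk≋ λ w →
  trans (coeff-lin f (scale c p) w) (trans (evaluate-scale _ c p)
    (sym (trans (coeff-scale c (lin f p) w) (cong (c *_) (coeff-lin f p w)))))

linear-id : Linear (λ p → p)
linear-id .cong-≋ e = e
linear-id .⊕-homo p q = ≋-refl
linear-id .scale-homo c p = ≋-refl

linear-zero : Linear (λ p → zeroP)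
linear-zero .cong-≋ e = ≋-refl
linear-zero .⊕-homo p q = ≋-refl
linear-zero .scale-homo c p = ≋-refl

linear-scale : ∀ c → Linear (scale c)
linear-scale c .cong-≋ = scale-cong c
linear-scale c .⊕-homo = scale-⊕ c
linear-scale c .scale-homo d p = scale-comm c d p

module _ {L M : Poly → Poly} (ℓ : Linear L) (m : Linear M) where

  linear-∘ : Linear (λ p → L (M p))
  linear-∘ .cong-≋ e = cong-≋ ℓ (cong-≋ m e)
  linear-∘ .⊕-homo p q = ≋-trans (cong-≋ ℓ (⊕-homo m p q)) (⊕-homo ℓ _ _)
  linear-∘ .scale-homo c p = ≋-trans (cong-≋ ℓ (scale-homo m c p)) (scale-homo ℓ c _)

  linear-⊕ : Linear (λ p → L p ⊕ M p)
  linear-⊕ .cong-≋ e = ⊕-cong (cong-≋ ℓ e) (cong-≋ m e)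
  linear-⊕ .⊕-homo p q = ≋-trans (⊕-cong (⊕-homo ℓ p q) (⊕-homo m p q))
    (⊕-interchange (L p) (L q) (M p) (M q))
  linear-⊕ .scale-homo c p = ≋-trans (⊕-cong (scale-homo ℓ c p) (scale-homo m c p))
    (≋-sym (scale-⊕ c (L p) (M p)))

linear-⊖ : ∀ {L M} → Linear L → Linear M → Linear (λ p → L p ⊖ M p)
linear-⊖ ℓ m = linear-⊕ ℓ (linear-∘ (linear-scale (- 1ℚ)) m)

lin-cong : ∀ {f g} → (∀ u → f u ≋ g u) → ∀ p → lin f p ≋ lin g p
lin-cong e [] = ≋-refl
lin-cong e ((a , u) ∷ p) = ⊕-cong (scale-cong a (e u)) (lin-cong e p)

lin-natural : ∀ {L} → Linear L → ∀ f p → lin (λ u → L (f u)) p ≋ L (lin f p)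
lin-natural ℓ f [] = ≋-sym (zero-homo ℓ)
lin-natural ℓ f ((a , u) ∷ p) =
  ≋-trans (⊕-cong (≋-sym (scale-homo ℓ a (f u))) (lin-natural ℓ f p)) (≋-sym (⊕-homo ℓ _ _))

lin-⊕ : ∀ f g p → lin (λ u → f u ⊕ g u) p ≋ lin f p ⊕ lin g p
lin-⊕ f g [] = ≋-refl
lin-⊕ f g ((a , u) ∷ p) = ≋-trans (⊕-cong (scale-⊕ a (f u) (g u)) (lin-⊕ f g p))
  (⊕-interchange (scale a (f u)) (scale a (g u)) (lin f p) (lin g p))

lin-mon : ∀ f u → lin f (mon u) ≋ f u
lin-mon f u = ≋-trans (additively (scale 1ℚ (f u) ∷ []) (v₀ :+ :0) v₀ refl) (scale-1 (f u))

lin-mon-id : ∀ p → lin mon p ≋ p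
lin-mon-id [] = ≋-refl
lin-mon-id ((a , u) ∷ p) = ⊕-cong {q′ = p}
  (≋-reflexive (cong (λ b → (b , u) ∷ []) (ℚ.*-identityʳ a))) (lin-mon-id p)

linear≋lin : ∀ {L} → Linear L → ∀ p → L p ≋ lin (λ u → L (mon u)) p
linear≋lin ℓ p = ≋-sym (≋-trans (lin-natural ℓ mon p) (cong-≋ ℓ (lin-mon-id p)))

linear-ext : ∀ {L M} → Linear L → Linear M → (∀ u → L (mon u) ≋ M (mon u)) → ∀ p → L p ≋ M p
linear-ext ℓ m e p = ≋-trans (linear≋lin ℓ p) (≋-trans (lin-cong e p) (≋-sym (linear≋lin m p)))

linear-≗ : ∀ {L M} → (∀ p → L p ≋ M p) → Linear M → Linear L
linear-≗ e m .cong-≋ {p} {q} f = ≋-trans (e p) (≋-trans (cong-≋ m f) (≋-sym (e q)))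
linear-≗ e m .⊕-homo p q = ≋-trans (e _) (≋-trans (⊕-homo m p q) (≋-sym (⊕-cong (e p) (e q))))
linear-≗ e m .scale-homo c p = ≋-trans (e _) (≋-trans (scale-homo m c p) (≋-sym (scale-cong c (e p))))

bilin≋lin : ∀ f p q → bilin f p q ≋ lin (λ u → lin (f u) q) p
bilin≋lin f [] q = ≋-refl
bilin≋lin f ((a , u) ∷ p) q = ⊕-cong (inner q) (bilin≋lin f p q)
  where
  inner : ∀ q → concatMap (λ { (b , v) → scale (a * b) (f u v) }) q ≋ scale a (lin (f u) q)
  inner [] = ≋-refl
  inner ((b , v) ∷ q) = ≋-trans (⊕-cong (scale-* a b (f u v)) (inner q))
    (≋-sym (scale-⊕ a (scale b (f u v)) (lin (f u) q)))

bilin-monˡ : ∀ f u q → bilin f (mon u) q ≋ lin (f u) q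
bilin-monˡ f u q = ≋-trans (bilin≋lin f (mon u) q) (lin-mon (λ u → lin (f u) q) u)

bilin-monʳ : ∀ f p v → bilin f p (mon v) ≋ lin (λ u → f u v) p
bilin-monʳ f p v = ≋-trans (bilin≋lin f p (mon v)) (lin-cong (λ u → lin-mon (f u) v) p)

bilin-mon : ∀ f u v → bilin f (mon u) (mon v) ≋ f u v
bilin-mon f u v = ≋-trans (bilin-monˡ f u (mon v)) (lin-mon (f u) v)

linear-bilinˡ : ∀ f q → Linear (λ p → bilin f p q)
linear-bilinˡ f q = linear-≗ (λ p → bilin≋lin f p q) (linear-lin (λ u → lin (f u) q))

linear-bilinʳ : ∀ f p → Linear (bilin f p)
linear-bilinʳ f p = linear-≗ (bilin≋lin f p) (family p)
  where
  family : ∀ p → Linear (λ q → lin (λ u → lin (f u) q) p)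
  family [] = linear-zero
  family ((a , u) ∷ p) = linear-⊕ (linear-∘ (linear-scale a) (linear-lin (f u))) (family p)

-- Operators on 𝔥 and generating series in a variable t

-- `_/_` normalises through a gcd that is stuck on a variable, so the identity is transported to
-- unnormalised rationals.
ℕ→ℚ-suc : ∀ n → ℕ→ℚ (suc n) ≡ 1ℚ + ℕ→ℚ n
ℕ→ℚ-suc n = ℚ.toℚᵘ-injective (ℚᵘ.≃-trans (ℚ.toℚᵘ-fromℚᵘ (mkℚᵘ (ℤ.+ suc n) 0)) (ℚᵘ.≃-sym (ℚᵘ.≃-trans
  (ℚ.toℚᵘ-homo-+ 1ℚ (ℕ→ℚ n)) (ℚᵘ.≃-trans (ℚᵘ.+-congʳ (toℚᵘ 1ℚ) (ℚ.toℚᵘ-fromℚᵘ (mkℚᵘ (ℤ.+ n) 0)))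
    (*≡* (cong (λ k → (ℤ.+ 1 ℤ.+ k) ℤ.* ℤ.+ 1) (ℤ.*-identityʳ (ℤ.+ n))))))))

prepend : Letter → Poly → Poly
prepend a = lin (λ u → mon (a ∷ u))

X Y S : Poly → Poly
X = prepend x
Y = prepend y
S p = X p ⊕ Y p

linear-prepend : ∀ a → Linear (prepend a)
linear-prepend a = linear-lin (λ u → mon (a ∷ u))

linear-X : Linear X
linear-X = linear-prepend x

linear-Y : Linear Y
linear-Y = linear-prepend y

linear-S : Linear S
linear-S = linear-⊕ linear-X linear-Y

prepend-mon : ∀ a u → prepend a (mon u) ≋ mon (a ∷ u)
prepend-mon a u = lin-mon (λ u → mon (a ∷ u)) u

lin-prepend : ∀ f a p → lin f (prepend a p) ≋ lin (λ u → f (a ∷ u)) p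
lin-prepend f a = linear-ext (linear-∘ (linear-lin f) (linear-prepend a)) (linear-lin (λ u → f (a ∷ u))) λ u →
  ≋-trans (cong-≋ (linear-lin f) (prepend-mon a u)) (≋-trans (lin-mon f (a ∷ u)) (≋-sym (lin-mon (λ u → f (a ∷ u)) u)))

linear-fold : ∀ {L} → Linear L → ∀ n → Linear (λ p → fold p L n)
linear-fold ℓ zero = linear-id
linear-fold ℓ (suc n) = linear-∘ ℓ (linear-fold ℓ n)

fold-comm : ∀ {L} → Linear L → ∀ p n → fold (L p) L n ≋ L (fold p L n)
fold-comm ℓ p zero = ≋-refl
fold-comm ℓ p (suc n) = cong-≋ ℓ (fold-comm ℓ p n)

Seq : Set
Seq = ℕ → Poly

-- (1 - t L)⁻¹ applied to the series f
geometric : (Poly → Poly) → Seq → Seq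
geometric L f zero = f zero
geometric L f (suc n) = f (suc n) ⊕ L (geometric L f n)

module _ {L : Poly → Poly} (ℓ : Linear L) where

  -- Comparing coefficients of t, the equation g = f + t L g has a single solution. Identities
  -- between series are reduced to checking this recursion.
  geometric-unique : ∀ {f g : Seq} → g 0 ≋ f 0 → (∀ n → g (suc n) ≋ f (suc n) ⊕ L (g n)) →
    ∀ n → g n ≋ geometric L f n
  geometric-unique e₀ e₊ zero = e₀
  geometric-unique {f} e₀ e₊ (suc n) =
    ≋-trans (e₊ n) (⊕-congˡ (f (suc n)) (cong-≋ ℓ (geometric-unique {f} e₀ e₊ n)))

  geometric-cong : ∀ {f g : Seq} → (∀ n → f n ≋ g n) → ∀ n → geometric L f n ≋ geometric L g n
  geometric-cong {f} {g} e = geometric-unique {g} (e 0) λ n → ⊕-congʳ (L (geometric L f n)) (e (suc n))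

  geometric-⊕ : ∀ (f g : Seq) n → geometric L f n ⊕ geometric L g n ≋ geometric L (λ k → f k ⊕ g k) n
  geometric-⊕ f g = geometric-unique {λ k → f k ⊕ g k} ≋-refl λ n →
    ≋-trans (⊕-interchange (f (suc n)) (L (geometric L f n)) (g (suc n)) (L (geometric L g n)))
      (⊕-congˡ (f (suc n) ⊕ g (suc n)) (≋-sym (⊕-homo ℓ (geometric L f n) (geometric L g n))))

  geometric-comm : ∀ (f : Seq) n → L (geometric L f n) ≋ geometric L (λ k → L (f k)) n
  geometric-comm f = geometric-unique {λ k → L (f k)} ≋-refl λ n → ⊕-homo ℓ (f (suc n)) (L (geometric L f n))

  linear-geometric : ∀ {M : ℕ → Poly → Poly} → (∀ k → Linear (M k)) →
    ∀ n → Linear (λ p → geometric L (λ k → M k p) n)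
  linear-geometric m zero = m zero
  linear-geometric m (suc n) = linear-⊕ (m (suc n)) (linear-∘ ℓ (linear-geometric m n))

-- The sum over i + j = n, that is, the coefficient of tⁿ in a Cauchy product. Recursion takes off i
-- = 0; `diagonal-last` takes off j = 0.
diagonal : (ℕ → ℕ → Poly) → Seq
diagonal Γ zero = Γ 0 0
diagonal Γ (suc n) = Γ 0 (suc n) ⊕ diagonal (λ i → Γ (suc i)) n

diagonal-cong : ∀ {Γ Δ : ℕ → ℕ → Poly} → (∀ i j → Γ i j ≋ Δ i j) → ∀ n → diagonal Γ n ≋ diagonal Δ n
diagonal-cong e zero = e 0 0
diagonal-cong e (suc n) = ⊕-cong (e 0 (suc n)) (diagonal-cong (λ i → e (suc i)) n)

diagonal-⊕ : ∀ (Γ Δ : ℕ → ℕ → Poly) n →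
  diagonal (λ i j → Γ i j ⊕ Δ i j) n ≋ diagonal Γ n ⊕ diagonal Δ n
diagonal-⊕ Γ Δ zero = ≋-refl
diagonal-⊕ Γ Δ (suc n) = ≋-trans
  (⊕-congˡ (Γ 0 (suc n) ⊕ Δ 0 (suc n)) (diagonal-⊕ (λ i → Γ (suc i)) (λ i → Δ (suc i)) n))
  (⊕-interchange (Γ 0 (suc n)) (Δ 0 (suc n)) (diagonal (λ i → Γ (suc i)) n) (diagonal (λ i → Δ (suc i)) n))

diagonal-natural : ∀ {L} → Linear L → ∀ (Γ : ℕ → ℕ → Poly) n →
  diagonal (λ i j → L (Γ i j)) n ≋ L (diagonal Γ n)
diagonal-natural ℓ Γ zero = ≋-refl
diagonal-natural {L} ℓ Γ (suc n) = ≋-trans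
  (⊕-congˡ (L (Γ 0 (suc n))) (diagonal-natural ℓ (λ i → Γ (suc i)) n)) (≋-sym (⊕-homo ℓ _ _))

diagonal-last : ∀ (Γ : ℕ → ℕ → Poly) n →
  diagonal Γ (suc n) ≋ diagonal (λ i j → Γ i (suc j)) n ⊕ Γ (suc n) 0
diagonal-last Γ zero = ≋-refl
diagonal-last Γ (suc n) = ≋-trans (⊕-congˡ a (diagonal-last (λ i → Γ (suc i)) n))
  (additively (a ∷ b ∷ c ∷ []) (v₀ :+ (v₁ :+ v₂)) ((v₀ :+ v₁) :+ v₂) refl)
  where
  a = Γ 0 (suc (suc n))
  b = diagonal (λ i j → Γ (suc i) (suc j)) n
  c = Γ (suc (suc n)) 0

-- (1 - t L)⁻¹ acts through the first index only, so it may be applied before or after the two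
-- indices are merged into one power of t.
diagonal-geometric : ∀ {L} → Linear L → ∀ (g : ℕ → ℕ → Poly) n →
  diagonal (λ i j → geometric L (λ k → g k j) i) n ≋ geometric L (diagonal g) n
diagonal-geometric {L} ℓ g = geometric-unique ℓ {diagonal g} ≋-refl λ n → begin
  g 0 (suc n) ⊕ diagonal (λ i j → g (suc i) j ⊕ L (Γ i j)) n
    ≈⟨ ⊕-congˡ (g 0 (suc n)) (≋-trans (diagonal-⊕ (λ i → g (suc i)) (λ i j → L (Γ i j)) n)
         (⊕-congˡ (diagonal (λ i → g (suc i)) n) (diagonal-natural ℓ Γ n))) ⟩
  g 0 (suc n) ⊕ (diagonal (λ i → g (suc i)) n ⊕ L (diagonal Γ n))
    ≈⟨ additively (g 0 (suc n) ∷ diagonal (λ i → g (suc i)) n ∷ L (diagonal Γ n) ∷ [])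
         (v₀ :+ (v₁ :+ v₂)) ((v₀ :+ v₁) :+ v₂) refl ⟩
  g 0 (suc n) ⊕ diagonal (λ i → g (suc i)) n ⊕ L (diagonal Γ n) ∎
  where
  Γ : ℕ → ℕ → Poly
  Γ i j = geometric L (λ k → g k j) i

-- This is (1 - t L)⁻¹ = Σ tⁱ Lⁱ. It turns the values y(x+y)ʲx of the derivations into y P x.
diagonal-fold : ∀ {L} → Linear L → ∀ (f : Seq) n → diagonal (λ i j → fold (f j) L i) n ≋ geometric L f n
diagonal-fold {L} ℓ f = geometric-unique ℓ {f} ≋-refl λ n →
  ⊕-congˡ (f (suc n)) (diagonal-natural ℓ (λ i j → fold (f j) L i) n)

-- The operator Σᵢ tⁱ L i applied to the series f
convolve : (ℕ → Poly → Poly) → Seq → Seq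
convolve L f = diagonal (λ i j → L i (f j))

constant : Poly → Seq
constant p zero = p
constant p (suc n) = zeroP

module _ {L : ℕ → Poly → Poly} (ℓ : ∀ i → Linear (L i)) where

  convolve-cong : ∀ {f g : Seq} → (∀ n → f n ≋ g n) → ∀ n → convolve L f n ≋ convolve L g n
  convolve-cong e = diagonal-cong (λ i j → cong-≋ (ℓ i) (e j))

  -- Multiplication by t commutes with Σ tⁱ `L i`; the two hypotheses encode f = g + t h.
  convolve-step : ∀ {f g h : Seq} → f 0 ≋ g 0 → (∀ n → f (suc n) ≋ g (suc n) ⊕ h n) →
    ∀ n → convolve L f (suc n) ≋ convolve L g (suc n) ⊕ convolve L h n
  convolve-step {f} {g} {h} e₀ e₊ n = begin
    convolve L f (suc n)
      ≈⟨ diagonal-last (λ i j → L i (f j)) n ⟩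
    diagonal (λ i j → L i (f (suc j))) n ⊕ L (suc n) (f 0)
      ≈⟨ ⊕-cong (≋-trans (diagonal-cong (λ i j → ≋-trans (cong-≋ (ℓ i) (e₊ j)) (⊕-homo (ℓ i) _ _)) n)
           (diagonal-⊕ (λ i j → L i (g (suc j))) (λ i j → L i (h j)) n)) (cong-≋ (ℓ (suc n)) e₀) ⟩
    a ⊕ b ⊕ c
      ≈⟨ additively (a ∷ b ∷ c ∷ []) (v₀ :+ v₁ :+ v₂) (v₀ :+ v₂ :+ v₁) refl ⟩
    a ⊕ c ⊕ b
      ≈⟨ ⊕-congʳ b (diagonal-last (λ i j → L i (g j)) n) ⟨
    convolve L g (suc n) ⊕ convolve L h n ∎
    where
    a = diagonal (λ i j → L i (g (suc j))) n
    b = convolve L h n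
    c = L (suc n) (g 0)

convolve-constant : ∀ {L} → (∀ i → Linear (L i)) → ∀ p n → convolve L (constant p) n ≋ L n p
convolve-constant ℓ p zero = ≋-refl
convolve-constant ℓ p (suc n) = ⊕-cong (zero-homo (ℓ 0)) (convolve-constant (λ i → ℓ (suc i)) p n)

-- Associativity of the Cauchy product, needed to pass from (∂ₜ A) B to ∂ₜ (A B).
convolve-assoc : ∀ {L} → (∀ i → Linear (L i)) → ∀ (M : ℕ → Poly → Poly) f n →
  convolve (λ i p → convolve L (λ j → M j p) i) f n ≋ convolve L (convolve M f) n
convolve-assoc ℓ M f zero = ≋-refl
convolve-assoc {L} ℓ M f (suc n) = begin
  a ⊕ diagonal (λ i j → L 0 (M (suc i) (f j)) ⊕ convolve L′ (λ k → M k (f j)) i) n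
    ≈⟨ ⊕-congˡ a (≋-trans (diagonal-⊕ (λ i j → L 0 (M (suc i) (f j))) (λ i j → convolve L′ (λ k → M k (f j)) i) n)
         (⊕-cong (diagonal-natural (ℓ 0) (λ i j → M (suc i) (f j)) n) (convolve-assoc (λ i → ℓ (suc i)) M f n))) ⟩
  a ⊕ (L 0 b ⊕ c)
    ≈⟨ additively (a ∷ L 0 b ∷ c ∷ []) (v₀ :+ (v₁ :+ v₂)) (v₀ :+ v₁ :+ v₂) refl ⟩
  a ⊕ L 0 b ⊕ c
    ≈⟨ ⊕-congʳ c (⊕-homo (ℓ 0) (M 0 (f (suc n))) b) ⟨
  L 0 (M 0 (f (suc n)) ⊕ b) ⊕ c ∎
  where
  L′ = λ i → L (suc i)
  a = L 0 (M 0 (f (suc n)))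
  b = diagonal (λ i j → M (suc i) (f j)) n
  c = convolve L′ (convolve M f) n

-- The derivations ∂ₘ

linear-·ˡ : ∀ q → Linear (_· q)
linear-·ˡ = linear-bilinˡ (λ u v → mon (u ++ v))

linear-·ʳ : ∀ p → Linear (p ·_)
linear-·ʳ = linear-bilinʳ (λ u v → mon (u ++ v))

mon-· : ∀ u v → mon u · mon v ≋ mon (u ++ v)
mon-· = bilin-mon (λ u v → mon (u ++ v))

prepend-· : ∀ a p q → prepend a p · q ≋ prepend a (p · q)
prepend-· a p q = linear-ext (linear-∘ (linear-·ˡ q) (linear-prepend a)) (linear-∘ (linear-prepend a) (linear-·ˡ q))
  (λ u → linear-ext (linear-·ʳ (prepend a (mon u))) (linear-∘ (linear-prepend a) (linear-·ʳ (mon u)))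
    (λ v → begin
      prepend a (mon u) · mon v ≈⟨ cong-≋ (linear-·ˡ (mon v)) (prepend-mon a u) ⟩
      mon (a ∷ u) · mon v ≈⟨ mon-· (a ∷ u) v ⟩
      mon (a ∷ u ++ v) ≈⟨ prepend-mon a (u ++ v) ⟨
      prepend a (mon (u ++ v)) ≈⟨ cong-≋ (linear-prepend a) (mon-· u v) ⟨
      prepend a (mon u · mon v) ∎) q) p

[]-· : ∀ p → mon [] · p ≋ p
[]-· = linear-ext (linear-·ʳ (mon [])) linear-id (mon-· [])

letter-· : ∀ a p → mon (a ∷ []) · p ≋ prepend a p
letter-· a p = begin
  mon (a ∷ []) · p ≈⟨ cong-≋ (linear-·ˡ p) (prepend-mon a []) ⟨
  prepend a (mon []) · p ≈⟨ prepend-· a (mon []) p ⟩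
  prepend a (mon [] · p) ≈⟨ cong-≋ (linear-prepend a) ([]-· p) ⟩
  prepend a p ∎

S-· : ∀ p q → S p · q ≋ S (p · q)
S-· p q = ≋-trans (⊕-homo (linear-·ˡ q) (X p) (Y p)) (⊕-cong (prepend-· x p q) (prepend-· y p q))

xpy^-suc : ∀ n → xpy^ (suc n) ≋ S (xpy^ n)
xpy^-suc n = extend (allWords n)
  where
  extend : ∀ ws → map (λ w → (1ℚ , w)) (concatMap (λ w → (x ∷ w) ∷ (y ∷ w) ∷ []) ws) ≋ S (map (λ w → (1ℚ , w)) ws)
  extend [] = ≋-refl
  extend (w ∷ ws) = ≋-trans (⊕-congˡ (mon (x ∷ w) ⊕ mon (y ∷ w)) (extend ws))
    (⊕-interchange (mon (x ∷ w)) (mon (y ∷ w)) (X (map (λ w → (1ℚ , w)) ws)) (Y (map (λ w → (1ℚ , w)) ws)))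

xpy^-· : ∀ n p → xpy^ n · p ≋ fold p S n
xpy^-· zero p = []-· p
xpy^-· (suc n) p = begin
  xpy^ (suc n) · p ≈⟨ cong-≋ (linear-·ˡ p) (xpy^-suc n) ⟩
  S (xpy^ n) · p ≈⟨ S-· (xpy^ n) p ⟩
  S (xpy^ n · p) ≈⟨ cong-≋ linear-S (xpy^-· n p) ⟩
  S (fold p S n) ∎

fold-S-· : ∀ p q n → fold p S n · q ≋ fold (p · q) S n
fold-S-· p q zero = ≋-refl
fold-S-· p q (suc n) = ≋-trans (S-· (fold p S n) q) (cong-≋ linear-S (fold-S-· p q n))

∂img-x-· : ∀ j p → ∂img (suc j) x · p ≋ Y (fold (X p) S j)
∂img-x-· j p = begin
  mon (y ∷ []) · xpy^ j · mon (x ∷ []) · p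
    ≈⟨ cong-≋ (linear-·ˡ p) (cong-≋ (linear-·ˡ (mon (x ∷ []))) (letter-· y (xpy^ j))) ⟩
  Y (xpy^ j) · mon (x ∷ []) · p
    ≈⟨ cong-≋ (linear-·ˡ p) (≋-trans (prepend-· y (xpy^ j) (mon (x ∷ []))) (cong-≋ linear-Y (xpy^-· j (mon (x ∷ []))))) ⟩
  Y (fold (mon (x ∷ [])) S j) · p
    ≈⟨ ≋-trans (prepend-· y (fold (mon (x ∷ [])) S j) p) (cong-≋ linear-Y (fold-S-· (mon (x ∷ [])) p j)) ⟩
  Y (fold (mon (x ∷ []) · p) S j)
    ≈⟨ cong-≋ linear-Y (cong-≋ (linear-fold linear-S j) (letter-· x p)) ⟩
  Y (fold (X p) S j) ∎

-- ∂ₘ is the coefficient of tᵐ⁻¹, so the shifted index is the exponent of t.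
∂⁺ : ℕ → Poly → Poly
∂⁺ j = ∂ (suc j)

linear-∂⁺ : ∀ j → Linear (∂⁺ j)
linear-∂⁺ j = linear-lin (∂W (suc j))

∂⁺-mon-∷ : ∀ j a w → ∂⁺ j (prepend a (mon w)) ≋ ∂img (suc j) a · mon w ⊕ prepend a (∂⁺ j (mon w))
∂⁺-mon-∷ j a w = begin
  ∂⁺ j (prepend a (mon w)) ≈⟨ cong-≋ (linear-∂⁺ j) (prepend-mon a w) ⟩
  ∂⁺ j (mon (a ∷ w)) ≈⟨ lin-mon (∂W (suc j)) (a ∷ w) ⟩
  ∂img (suc j) a · mon w ⊕ mon (a ∷ []) · ∂W (suc j) w
    ≈⟨ ⊕-congˡ (∂img (suc j) a · mon w) (≋-trans (letter-· a (∂W (suc j) w))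
         (cong-≋ (linear-prepend a) (≋-sym (lin-mon (∂W (suc j)) w)))) ⟩
  ∂img (suc j) a · mon w ⊕ prepend a (∂⁺ j (mon w)) ∎

linear-YSX : ∀ j → Linear (λ p → Y (fold (X p) S j))
linear-YSX j = linear-∘ linear-Y (linear-∘ (linear-fold linear-S j) linear-X)

∂⁺-X : ∀ j p → ∂⁺ j (X p) ≋ Y (fold (X p) S j) ⊕ X (∂⁺ j p)
∂⁺-X j = linear-ext (linear-∘ (linear-∂⁺ j) linear-X)
  (linear-⊕ (linear-YSX j) (linear-∘ linear-X (linear-∂⁺ j))) λ w →
  ≋-trans (∂⁺-mon-∷ j x w) (⊕-congʳ (X (∂⁺ j (mon w))) (∂img-x-· j (mon w)))

-- The negative value at `y` is moved to the left, so that no negative scalar has to be carried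
-- through the series.
∂⁺-Y : ∀ j p → ∂⁺ j (Y p) ⊕ Y (fold (X p) S j) ≋ Y (∂⁺ j p)
∂⁺-Y j = linear-ext (linear-⊕ (linear-∘ (linear-∂⁺ j) linear-Y) (linear-YSX j)) (linear-∘ linear-Y (linear-∂⁺ j)) λ w →
  let a = Y (∂⁺ j (mon w)); b = Y (fold (X (mon w)) S j) in begin
  ∂⁺ j (Y (mon w)) ⊕ b
    ≈⟨ ⊕-congʳ b (∂⁺-mon-∷ j y w) ⟩
  scale (- 1ℚ) (∂img (suc j) x) · mon w ⊕ a ⊕ b
    ≈⟨ ⊕-congʳ b (⊕-congʳ a (≋-trans (scale-homo (linear-·ˡ (mon w)) (- 1ℚ) (∂img (suc j) x))
         (scale-cong (- 1ℚ) (∂img-x-· j (mon w))))) ⟩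
  (zeroP ⊖ b) ⊕ a ⊕ b
    ≈⟨ additively (a ∷ b ∷ []) ((:0 :- v₁) :+ v₀ :+ v₁) v₀ refl ⟩
  a ∎

-- The values at `x` and `y` are opposite, so the derivation kills x + y.
∂⁺-S : ∀ j p → ∂⁺ j (S p) ≋ S (∂⁺ j p)
∂⁺-S j p = begin
  ∂⁺ j (X p ⊕ Y p) ≈⟨ ⊕-homo (linear-∂⁺ j) (X p) (Y p) ⟩
  ∂⁺ j (X p) ⊕ ∂⁺ j (Y p) ≈⟨ ⊕-congʳ (∂⁺ j (Y p)) (∂⁺-X j p) ⟩
  a ⊕ b ⊕ c ≈⟨ additively (a ∷ b ∷ c ∷ []) (v₀ :+ v₁ :+ v₂) (v₁ :+ (v₂ :+ v₀)) refl ⟩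
  b ⊕ (c ⊕ a) ≈⟨ ⊕-congˡ b (∂⁺-Y j p) ⟩
  S (∂⁺ j p) ∎
  where
  a = Y (fold (X p) S j)
  b = X (∂⁺ j p)
  c = ∂⁺ j (Y p)

∂ₜ : Seq → Seq
∂ₜ = convolve ∂⁺

P : Seq → Seq
P = geometric S

∂ₜ-X : ∀ f n → ∂ₜ (λ k → X (f k)) n ≋ Y (P (λ k → X (f k)) n) ⊕ X (∂ₜ f n)
∂ₜ-X f n = begin
  diagonal (λ i j → ∂⁺ i (X (f j))) n
    ≈⟨ diagonal-cong (λ i j → ∂⁺-X i (f j)) n ⟩
  diagonal (λ i j → Y (fold (X (f j)) S i) ⊕ X (∂⁺ i (f j))) n
    ≈⟨ diagonal-⊕ (λ i j → Y (fold (X (f j)) S i)) (λ i j → X (∂⁺ i (f j))) n ⟩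
  diagonal (λ i j → Y (fold (X (f j)) S i)) n ⊕ diagonal (λ i j → X (∂⁺ i (f j))) n
    ≈⟨ ⊕-cong (≋-trans (diagonal-natural linear-Y (λ i j → fold (X (f j)) S i) n)
         (cong-≋ linear-Y (diagonal-fold linear-S (λ j → X (f j)) n)))
         (diagonal-natural linear-X (λ i j → ∂⁺ i (f j)) n) ⟩
  Y (P (λ k → X (f k)) n) ⊕ X (∂ₜ f n) ∎

∂ₜ-Y : ∀ f n → ∂ₜ (λ k → Y (f k)) n ⊕ Y (P (λ k → X (f k)) n) ≋ Y (∂ₜ f n)
∂ₜ-Y f n = begin
  ∂ₜ (λ k → Y (f k)) n ⊕ Y (P (λ k → X (f k)) n)
    ≈⟨ ⊕-congˡ (∂ₜ (λ k → Y (f k)) n) (≋-trans (diagonal-natural linear-Y (λ i j → fold (X (f j)) S i) n)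
         (cong-≋ linear-Y (diagonal-fold linear-S (λ j → X (f j)) n))) ⟨
  ∂ₜ (λ k → Y (f k)) n ⊕ diagonal (λ i j → Y (fold (X (f j)) S i)) n
    ≈⟨ diagonal-⊕ (λ i j → ∂⁺ i (Y (f j))) (λ i j → Y (fold (X (f j)) S i)) n ⟨
  diagonal (λ i j → ∂⁺ i (Y (f j)) ⊕ Y (fold (X (f j)) S i)) n
    ≈⟨ diagonal-cong (λ i j → ∂⁺-Y i (f j)) n ⟩
  diagonal (λ i j → Y (∂⁺ i (f j))) n
    ≈⟨ diagonal-natural linear-Y (λ i j → ∂⁺ i (f j)) n ⟩
  Y (∂ₜ f n) ∎

∂ₜ-P : ∀ f n → ∂ₜ (P f) n ≋ P (∂ₜ f) n
∂ₜ-P f = geometric-unique linear-S {∂ₜ f} ≋-refl λ n →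
  ≋-trans (convolve-step linear-∂⁺ {P f} {f} {λ k → S (P f k)} ≋-refl (λ _ → ≋-refl) n)
    (⊕-congˡ (∂ₜ f (suc n)) (≋-trans (diagonal-cong (λ i j → ∂⁺-S i (P f j)) n)
      (diagonal-natural linear-S (λ i j → ∂⁺ i (P f j)) n)))

derivative : Seq → Seq
derivative f n = scale (ℕ→ℚ (suc n)) (f (suc n))

derivative-suc : ∀ f n → derivative f (suc n) ≋ f (suc (suc n)) ⊕ scale (ℕ→ℚ (suc n)) (f (suc (suc n)))
derivative-suc f n = begin
  scale (ℕ→ℚ (suc (suc n))) g ≡⟨ cong (λ c → scale c g) (ℕ→ℚ-suc (suc n)) ⟩
  scale (1ℚ + ℕ→ℚ (suc n)) g ≈⟨ scale-+ 1ℚ (ℕ→ℚ (suc n)) g ⟩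
  scale 1ℚ g ⊕ scale (ℕ→ℚ (suc n)) g ≈⟨ ⊕-congʳ (scale (ℕ→ℚ (suc n)) g) (scale-1 g) ⟩
  g ⊕ scale (ℕ→ℚ (suc n)) g ∎
  where g = f (suc (suc n))

-- Differentiating P f = f + t S (P f) gives f′ + S (P f) + t S (P f)′, the recursion of a geometric
-- series; the middle term comes from the factor t.
derivative-P : ∀ f n → derivative (P f) n ≋ P (λ k → derivative f k ⊕ S (P f k)) n
derivative-P f = geometric-unique linear-S {λ k → derivative f k ⊕ S (P f k)}
  (≋-trans (scale-1 (P f 1)) (⊕-congʳ (S (f 0)) (≋-sym (scale-1 (f 1))))) step
  where
  step : ∀ n → derivative (P f) (suc n) ≋ derivative f (suc n) ⊕ S (P f (suc n)) ⊕ S (derivative (P f) n)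
  step n = begin
    derivative (P f) (suc n)
      ≈⟨ derivative-suc (P f) n ⟩
    a ⊕ b ⊕ scale c (a ⊕ b)
      ≈⟨ ⊕-congˡ (a ⊕ b) (≋-trans (scale-⊕ c a b) (⊕-congˡ (scale c a) (≋-sym (scale-homo linear-S c (P f (suc n)))))) ⟩
    a ⊕ b ⊕ (scale c a ⊕ d)
      ≈⟨ additively (a ∷ b ∷ scale c a ∷ d ∷ []) (v₀ :+ v₁ :+ (v₂ :+ v₃)) (v₀ :+ v₂ :+ v₁ :+ v₃) refl ⟩
    a ⊕ scale c a ⊕ b ⊕ d
      ≈⟨ ⊕-congʳ d (⊕-congʳ b (derivative-suc f n)) ⟨
    derivative f (suc n) ⊕ b ⊕ d ∎
    where
    a = f (suc (suc n))
    b = S (P f (suc n))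
    c = ℕ→ℚ (suc n)
    d = S (derivative (P f) n)

-- The action of Σₙ tⁿ {1}⋆ⁿ, and its commutator with y ⧢̲ _

-- {1}⋆ⁿ ∗̲ y w = y (T w n); with P = (1 - t(x+y))⁻¹ the series T w is the image of w under
-- x ↦ x, y ↦ P y, multiplied on the right by (1 - t x)⁻¹.
T : Word → Seq
T [] zero = mon []
T [] (suc n) = X (T [] n)
T (x ∷ w) n = X (T w n)
T (y ∷ w) n = P (λ k → Y (T w k)) n

Tₗ : ℕ → Poly → Poly
Tₗ n = lin (λ w → T w n)

linear-Tₗ : ∀ n → Linear (Tₗ n)
linear-Tₗ n = linear-lin (λ w → T w n)

Tₗ-mon : ∀ n w → Tₗ n (mon w) ≋ T w n
Tₗ-mon n = lin-mon (λ w → T w n)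

Tₗ-X : ∀ n p → Tₗ n (X p) ≋ X (Tₗ n p)
Tₗ-X n p = ≋-trans (lin-prepend (λ w → T w n) x p) (lin-natural linear-X (λ w → T w n) p)

Tₗ-Y : ∀ n p → Tₗ n (Y p) ≋ P (λ k → Y (Tₗ k p)) n
Tₗ-Y n = linear-ext (linear-∘ (linear-Tₗ n) linear-Y)
  (linear-geometric linear-S (λ k → linear-∘ linear-Y (linear-Tₗ k)) n) λ w → begin
    Tₗ n (Y (mon w)) ≈⟨ cong-≋ (linear-Tₗ n) (prepend-mon y w) ⟩
    Tₗ n (mon (y ∷ w)) ≈⟨ Tₗ-mon n (y ∷ w) ⟩
    P (λ k → Y (T w k)) n ≈⟨ geometric-cong linear-S (λ k → cong-≋ linear-Y (Tₗ-mon k w)) n ⟨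
    P (λ k → Y (Tₗ k (mon w))) n ∎

-- This is y ⧢̲ y w with the initial y split off: a y goes in front of each letter of w, but not
-- after the last one.
insertions : Word → Poly
insertions [] = zeroP
insertions (a ∷ w) = mon (y ∷ a ∷ w) ⊕ prepend a (insertions w)

-- Let R = (1 - t x)⁻¹. Then R′ = R x R and ∂ₜ R = t R y P x R, and P = R (1 + t y P) makes their
-- sum P x R. The zero summand in the proof is a derivation applied to the empty word.
T-insertions-[] : ∀ n → P (λ k → X (T [] k)) n ≋ derivative (T []) n ⊕ ∂ₜ (T []) n
T-insertions-[] zero = ≋-trans (≋-sym (scale-1 (X (mon []))))
  (additively (scale 1ℚ (X (mon [])) ∷ []) v₀ (v₀ :+ :0) refl)
T-insertions-[] (suc n) = begin
  a ⊕ (X p ⊕ Y p)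
    ≈⟨ ⊕-congˡ a (⊕-congʳ (Y p) (≋-trans (cong-≋ linear-X (T-insertions-[] n)) (⊕-homo linear-X d e))) ⟩
  a ⊕ (X d ⊕ X e ⊕ Y p)
    ≈⟨ additively (a ∷ X d ∷ X e ∷ Y p ∷ []) (v₀ :+ (v₁ :+ v₂ :+ v₃)) (v₀ :+ v₁ :+ (v₃ :+ v₂ :+ :0)) refl ⟩
  a ⊕ X d ⊕ (Y p ⊕ X e ⊕ zeroP)
    ≈⟨ ⊕-cong (⊕-congˡ a (scale-homo linear-X (ℕ→ℚ (suc n)) (T [] (suc n)))) (⊕-congʳ zeroP (≋-sym (∂ₜ-X (T []) n))) ⟩
  a ⊕ scale (ℕ→ℚ (suc n)) a ⊕ (∂ₜ (λ k → X (T [] k)) n ⊕ zeroP)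
    ≈⟨ ⊕-cong (derivative-suc (T []) n) (diagonal-last (λ i j → ∂⁺ i (T [] j)) n) ⟨
  derivative (T []) (suc n) ⊕ ∂ₜ (T []) (suc n) ∎
  where
  a = X (T [] (suc n))
  p = P (λ k → X (T [] k)) n
  d = derivative (T []) n
  e = ∂ₜ (T []) n

-- Differentiating y ↦ P y, x ↦ x shows that both sides obey the same recursion on w, because
-- P commutes with x + y and is killed by ∂ₜ, while P′ = P (x + y) P.
T-insertions : ∀ w n →
  Tₗ n (insertions w) ⊕ P (λ k → X (T w k)) n ≋ derivative (T w) n ⊕ ∂ₜ (T w) n
T-insertions [] n = T-insertions-[] n
T-insertions (x ∷ w) n = begin
  Tₗ n (mon (y ∷ x ∷ w) ⊕ X (insertions w)) ⊕ P (λ k → X (X (T w k))) n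
    ≈⟨ ⊕-congʳ b (≋-trans (⊕-homo (linear-Tₗ n) (mon (y ∷ x ∷ w)) (X (insertions w)))
         (⊕-cong (Tₗ-mon n (y ∷ x ∷ w)) (Tₗ-X n (insertions w)))) ⟩
  a ⊕ X c ⊕ b
    ≈⟨ additively (a ∷ X c ∷ b ∷ []) (v₀ :+ v₁ :+ v₂) (v₁ :+ (v₂ :+ v₀)) refl ⟩
  X c ⊕ (b ⊕ a)
    -- `a` and `b` add up to `P` of `S (X (T w))`, and `P` commutes with `S`.
    ≈⟨ ⊕-congˡ (X c) (≋-trans (geometric-⊕ linear-S (λ k → X (X (T w k))) (λ k → Y (X (T w k))) n)
         (≋-sym (geometric-comm linear-S (λ k → X (T w k)) n))) ⟩
  X c ⊕ (X p ⊕ Y p)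
    ≈⟨ additively (X c ∷ X p ∷ Y p ∷ []) (v₀ :+ (v₁ :+ v₂)) (v₀ :+ v₁ :+ v₂) refl ⟩
  X c ⊕ X p ⊕ Y p
    ≈⟨ ⊕-congʳ (Y p) (≋-trans (≋-sym (⊕-homo linear-X c p)) (≋-trans (cong-≋ linear-X (T-insertions w n)) (⊕-homo linear-X d e))) ⟩
  X d ⊕ X e ⊕ Y p
    ≈⟨ additively (X d ∷ X e ∷ Y p ∷ []) (v₀ :+ v₁ :+ v₂) (v₀ :+ (v₂ :+ v₁)) refl ⟩
  X d ⊕ (Y p ⊕ X e)
    ≈⟨ ⊕-cong (scale-homo linear-X (ℕ→ℚ (suc n)) (T w (suc n))) (≋-sym (∂ₜ-X (T w) n)) ⟩
  derivative (T (x ∷ w)) n ⊕ ∂ₜ (T (x ∷ w)) n ∎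
  where
  a = P (λ k → Y (X (T w k))) n
  b = P (λ k → X (X (T w k))) n
  c = Tₗ n (insertions w)
  p = P (λ k → X (T w k)) n
  d = derivative (T w) n
  e = ∂ₜ (T w) n
T-insertions (y ∷ w) n = begin
  Tₗ n (mon (y ∷ y ∷ w) ⊕ Y (insertions w)) ⊕ b
    ≈⟨ ⊕-congʳ b (≋-trans (⊕-homo (linear-Tₗ n) (mon (y ∷ y ∷ w)) (Y (insertions w)))
         (⊕-cong (Tₗ-mon n (y ∷ y ∷ w)) (Tₗ-Y n (insertions w)))) ⟩
  a ⊕ c ⊕ b
    ≈⟨ additively (a ∷ c ∷ b ∷ []) (v₀ :+ v₁ :+ v₂) (v₁ :+ (v₂ :+ v₀)) refl ⟩
  c ⊕ (b ⊕ a)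
    -- Here `b ⊕ a` becomes `f`, the term P (x + y) P y (T w) that comes from differentiating P.
    ≈⟨ ⊕-cong (≋-trans (geometric-cong linear-S inner n) (≋-sym (geometric-⊕ linear-S d e n)))
         (geometric-⊕ linear-S (λ k → X (g k)) (λ k → Y (g k)) n) ⟩
  P d n ⊕ P e n ⊕ f
    ≈⟨ additively (P d n ∷ P e n ∷ f ∷ []) (v₀ :+ v₁ :+ v₂) (v₀ :+ v₂ :+ v₁) refl ⟩
  P d n ⊕ f ⊕ P e n
    ≈⟨ ⊕-cong (≋-trans (geometric-⊕ linear-S d (λ k → S (g k)) n) (≋-sym (derivative-P (λ k → Y (T w k)) n)))
         (≋-sym (∂ₜ-P (λ k → Y (T w k)) n)) ⟩
  derivative (T (y ∷ w)) n ⊕ ∂ₜ (T (y ∷ w)) n ∎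
  where
  g = T (y ∷ w)
  a = P (λ k → Y (g k)) n
  b = P (λ k → X (g k)) n
  c = P (λ k → Y (Tₗ k (insertions w))) n
  d = derivative (λ k → Y (T w k))
  e = ∂ₜ (λ k → Y (T w k))
  f = P (λ k → S (g k)) n
  inner : ∀ k → Y (Tₗ k (insertions w)) ≋ d k ⊕ e k
  -- The term `q` of the induction hypothesis is, under `Y`, the correction term of `∂ₜ-Y`.
  inner k = ⊕-cancelʳ (Y q) (begin
    Y (Tₗ k (insertions w)) ⊕ Y q
      ≈⟨ ⊕-homo linear-Y (Tₗ k (insertions w)) q ⟨
    Y (Tₗ k (insertions w) ⊕ q)
      ≈⟨ cong-≋ linear-Y (T-insertions w k) ⟩
    Y (derivative (T w) k ⊕ ∂ₜ (T w) k)
      ≈⟨ ⊕-homo linear-Y (derivative (T w) k) (∂ₜ (T w) k) ⟩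
    Y (derivative (T w) k) ⊕ Y (∂ₜ (T w) k)
      ≈⟨ ⊕-cong (scale-homo linear-Y (ℕ→ℚ (suc k)) (T w (suc k))) (≋-sym (∂ₜ-Y (T w) k)) ⟩
    d k ⊕ (e k ⊕ Y q)
      ≈⟨ additively (d k ∷ e k ∷ Y q ∷ []) (v₀ :+ (v₁ :+ v₂)) (v₀ :+ v₁ :+ v₂) refl ⟩
    d k ⊕ e k ⊕ Y q ∎)
    where q = P (λ k → X (T w k)) k

-- The inner shuffle product with y

map≋lin : ∀ (h : Word → Word) p → map (λ { (c , v) → (c , h v) }) p ≋ lin (λ v → mon (h v)) p
map≋lin h [] = ≋-refl
map≋lin h ((a , u) ∷ p) = ⊕-cong {(a , h u) ∷ []}
  (≋-reflexive (cong (λ b → (b , h u) ∷ []) (sym (ℚ.*-identityʳ a)))) (map≋lin h p)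

-- The local `shWa` in the definition of `shW` is a copy of `shW (a ∷ u)`; splitting on `v` makes
-- both compute.
shW-∷ : ∀ a u b v → shW (a ∷ u) (b ∷ v) ≡
  map (λ { (c , w) → (c , a ∷ w) }) (shW u (b ∷ v)) ++ map (λ { (c , w) → (c , b ∷ w) }) (shW (a ∷ u) v)
shW-∷ a u b [] = refl
shW-∷ a u b (_ ∷ _) = refl

-- y ⧢ w reaches every gap of w, both ends included; once a is appended, the final gap is the one
-- just before a.
insertions-snoc : ∀ w a → insertions (w ++ a ∷ []) ≋ lin (λ v → mon (v ++ a ∷ [])) (shW (y ∷ []) w)
insertions-snoc [] a = ≋-sym (lin-mon (λ v → mon (v ++ a ∷ [])) (y ∷ []))
insertions-snoc (b ∷ w) a = begin
  mon (y ∷ b ∷ w ++ a ∷ []) ⊕ prepend b (insertions (w ++ a ∷ []))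
    ≈⟨ ⊕-cong (≋-sym (lin-mon f (y ∷ b ∷ w))) (≋-trans (cong-≋ (linear-prepend b) (insertions-snoc w a))
         (≋-trans (≋-sym (lin-natural (linear-prepend b) f (shW (y ∷ []) w)))
           (lin-cong (λ v → prepend-mon b (v ++ a ∷ [])) (shW (y ∷ []) w)))) ⟩
  lin f (mon (y ∷ b ∷ w)) ⊕ lin (λ v → f (b ∷ v)) (shW (y ∷ []) w)
    ≈⟨ ⊕-congˡ (lin f (mon (y ∷ b ∷ w))) (≋-trans (≋-sym (lin-prepend f b (shW (y ∷ []) w)))
         (cong-≋ (linear-lin f) (≋-sym (map≋lin (b ∷_) (shW (y ∷ []) w))))) ⟩
  lin f (mon (y ∷ b ∷ w)) ⊕ lin f (map (λ { (c , v) → (c , b ∷ v) }) (shW (y ∷ []) w))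
    ≈⟨ ⊕-homo (linear-lin f) (mon (y ∷ b ∷ w)) (map (λ { (c , v) → (c , b ∷ v) }) (shW (y ∷ []) w)) ⟨
  lin f (mon (y ∷ b ∷ w) ⊕ map (λ { (c , v) → (c , b ∷ v) }) (shW (y ∷ []) w))
    ≡⟨ cong (lin f) (shW-∷ y [] b w) ⟨
  lin f (shW (y ∷ []) (b ∷ w)) ∎
  where
  f : Word → Poly
  f v = mon (v ++ a ∷ [])

initLast-just : ∀ w {v a} → initLast w ≡ just (v , a) → w ≡ v ++ a ∷ []
initLast-just (a ∷ []) refl = refl
initLast-just (a ∷ b ∷ w) eq with initLast (b ∷ w) in eq′
initLast-just (a ∷ b ∷ w) refl | just (v , c) = cong (a ∷_) (initLast-just (b ∷ w) eq′)

initLast-∷ : ∀ a w → initLast (a ∷ w) ≢ nothing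
initLast-∷ a [] ()
initLast-∷ a (b ∷ w) eq with initLast (b ∷ w) in eq′
... | nothing = initLast-∷ b w eq′

initLast-nothing : ∀ w → initLast w ≡ nothing → w ≡ []
initLast-nothing [] eq = refl
initLast-nothing (a ∷ w) eq = contradiction eq (initLast-∷ a w)

innerShW-y : ∀ w → innerShW (y ∷ []) (y ∷ w) ≋ Y (insertions w)
innerShW-y w with initLast w in eq
... | nothing rewrite initLast-nothing w eq = ≋-refl
... | just (v , a) rewrite initLast-just w eq = begin
  map (λ { (c , u) → (c , y ∷ (u ++ a ∷ [])) }) (shW (y ∷ []) v)
    ≈⟨ map≋lin (λ u → y ∷ (u ++ a ∷ [])) (shW (y ∷ []) v) ⟩
  lin (λ u → mon (y ∷ (u ++ a ∷ []))) (shW (y ∷ []) v)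
    ≈⟨ lin-cong (λ u → prepend-mon y (u ++ a ∷ [])) (shW (y ∷ []) v) ⟨
  lin (λ u → Y (mon (u ++ a ∷ []))) (shW (y ∷ []) v)
    ≈⟨ lin-natural linear-Y (λ u → mon (u ++ a ∷ [])) (shW (y ∷ []) v) ⟩
  Y (lin (λ u → mon (u ++ a ∷ [])) (shW (y ∷ []) v))
    ≈⟨ cong-≋ linear-Y (insertions-snoc v a) ⟨
  Y (insertions (v ++ a ∷ [])) ∎

-- Admissible patterns

hasG : List Label → Bool
hasG [] = false
hasG (F ∷ p) = hasG p
hasG (G ∷ p) = true
hasG (B ∷ p) = true

-- The bound f(i) ≤ g(s) alone: some `G` or `B` must follow each `F`. Testing this at every `F`
-- matches the conjunction over `imF` term by term.
notEndingInF : List Label → Bool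
notEndingInF [] = true
notEndingInF (F ∷ p) = hasG p ∧ notEndingInF p
notEndingInF (G ∷ p) = notEndingInF p
notEndingInF (B ∷ p) = notEndingInF p

≤ᵇ-true : ∀ {m n} → m ≤ n → (m ≤ᵇ n) ≡ true
≤ᵇ-true {m} {n} = dec-true (m ℕ.≤? n)

≤ᵇ-false : ∀ {m n} → n < m → (m ≤ᵇ n) ≡ false
≤ᵇ-false {m} {n} n<m = dec-false (m ℕ.≤? n) (ℕ.<⇒≱ n<m)

lastN-imG-≥ : ∀ {c i} p → c ≤ i → c ≤ lastN (c ∷ imG i p)
lastN-imG-≥ [] c≤i = ℕ.≤-refl
lastN-imG-≥ (F ∷ p) c≤i = lastN-imG-≥ p (ℕ.m≤n⇒m≤1+n c≤i)
lastN-imG-≥ {i = i} (G ∷ p) c≤i = ℕ.≤-trans c≤i (lastN-imG-≥ p (ℕ.n≤1+n i))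
lastN-imG-≥ {i = i} (B ∷ p) c≤i = ℕ.≤-trans c≤i (lastN-imG-≥ p (ℕ.n≤1+n i))

-- `c` is the latest element of Im g before position `i`. As c < j ≤ i, the last element reaches `j`
-- exactly when `p` contributes one more.
≤ᵇ-lastN-imG : ∀ {c j i} p → c < j → j ≤ i → (j ≤ᵇ lastN (c ∷ imG i p)) ≡ hasG p
≤ᵇ-lastN-imG [] c<j j≤i = ≤ᵇ-false c<j
≤ᵇ-lastN-imG (F ∷ p) c<j j≤i = ≤ᵇ-lastN-imG p c<j (ℕ.m≤n⇒m≤1+n j≤i)
≤ᵇ-lastN-imG {i = i} (G ∷ p) c<j j≤i = ≤ᵇ-true (ℕ.≤-trans j≤i (lastN-imG-≥ p (ℕ.n≤1+n i)))
≤ᵇ-lastN-imG {i = i} (B ∷ p) c<j j≤i = ≤ᵇ-true (ℕ.≤-trans j≤i (lastN-imG-≥ p (ℕ.n≤1+n i)))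

-- `h` and `c` stand for the first and the latest element of Im g before `i`. The lower bound is
-- then automatic for all remaining positions.
allB-imF : ∀ {h c i} p → h ≤ i → c < i →
  allB (λ j → (h ≤ᵇ j) ∧ (j ≤ᵇ lastN (c ∷ imG i p))) (imF i p) ≡ notEndingInF p
allB-imF [] h≤i c<i = refl
allB-imF (F ∷ p) h≤i c<i = cong₂ _∧_
  (cong₂ _∧_ (≤ᵇ-true h≤i) (≤ᵇ-lastN-imG p c<i (ℕ.n≤1+n _)))
  (allB-imF p (ℕ.m≤n⇒m≤1+n h≤i) (ℕ.m≤n⇒m≤1+n c<i))
allB-imF (G ∷ p) h≤i c<i = allB-imF p (ℕ.m≤n⇒m≤1+n h≤i) (ℕ.n<1+n _)
allB-imF {i = i} (B ∷ p) h≤i c<i = cong₂ _∧_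
  (cong₂ _∧_ (≤ᵇ-true h≤i) (≤ᵇ-true (lastN-imG-≥ p (ℕ.n≤1+n i))))
  (allB-imF p (ℕ.m≤n⇒m≤1+n h≤i) (ℕ.n<1+n _))

headN-imG-≥ : ∀ {i} p → hasG p ≡ true → i ≤ headN (imG i p)
headN-imG-≥ (F ∷ p) eq = ℕ.≤-trans (ℕ.n≤1+n _) (headN-imG-≥ p eq)
headN-imG-≥ (G ∷ p) eq = ℕ.≤-refl
headN-imG-≥ (B ∷ p) eq = ℕ.≤-refl

-- Position 1 lies in Im f, while g(1) ≥ 2: the lower bound fails.
admissible-F : ∀ {p} → hasG p ≡ true → admissible (F ∷ p) ≡ false
admissible-F {p} eq rewrite ≤ᵇ-false {headN (imG 2 p)} {1} (headN-imG-≥ p eq) = refl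

admissible-G : ∀ p → admissible (G ∷ p) ≡ notEndingInF p
admissible-G p = allB-imF p (s≤s z≤n) ℕ.≤-refl

admissible-B : ∀ p → admissible (B ∷ p) ≡ notEndingInF p
admissible-B p rewrite ≤ᵇ-true (lastN-imG-≥ {1} {2} p (s≤s z≤n)) = admissible-G p

pats-hasG : ∀ r s → All (λ p → hasG p ≡ true) (pats r (suc s))
pats-hasG zero s = All.map⁺ (All.universal (λ _ → refl) (pats zero s))
pats-hasG (suc r) s = All.++⁺ (All.map⁺ (pats-hasG r s))
  (All.++⁺ (All.map⁺ (All.universal (λ _ → refl) (pats (suc r) s))) (All.map⁺ (All.universal (λ _ → refl) (pats r s))))

pats-noG : ∀ r → All (λ p → hasG p ≡ false) (pats r zero)
pats-noG zero = refl ∷ []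
pats-noG (suc r) = All.map⁺ (pats-noG r)

module _ {A : Set} where

  filterB-++ : ∀ (P : A → Bool) as bs → filterB P (as ++ bs) ≡ filterB P as ++ filterB P bs
  filterB-++ P [] bs = refl
  filterB-++ P (a ∷ as) bs with P a
  ... | true = cong (a ∷_) (filterB-++ P as bs)
  ... | false = filterB-++ P as bs

  filterB-map : ∀ {C : Set} (P : A → Bool) (f : C → A) cs → filterB P (map f cs) ≡ map f (filterB (λ c → P (f c)) cs)
  filterB-map P f [] = refl
  filterB-map P f (c ∷ cs) with P (f c)
  ... | true = cong (f c ∷_) (filterB-map P f cs)
  ... | false = filterB-map P f cs

  filterB-cong : ∀ {P Q : A → Bool} {as} → All (λ a → P a ≡ Q a) as → filterB P as ≡ filterB Q as
  filterB-cong [] = refl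
  filterB-cong {P} {Q} {a ∷ _} (eq ∷ eqs) rewrite eq with Q a
  ... | true = cong (a ∷_) (filterB-cong eqs)
  ... | false = filterB-cong eqs

  filterB-none : ∀ {P : A → Bool} {as} → All (λ a → P a ≡ false) as → filterB P as ≡ []
  filterB-none [] = refl
  filterB-none (eq ∷ eqs) rewrite eq = filterB-none eqs

filterB-map-cong : ∀ {A C : Set} {P : A → Bool} {Q : C → Bool} {f : C → A} {cs} → All (λ c → P (f c) ≡ Q c) cs →
  filterB P (map f cs) ≡ map f (filterB Q cs)
filterB-map-cong {P = P} {f = f} {cs} eqs = trans (filterB-map P f cs) (cong (map f) (filterB-cong eqs))

admissible-pats : ∀ r s → filterB admissible (pats (suc r) (suc s)) ≡
  map (G ∷_) (filterB notEndingInF (pats (suc r) s)) ++ map (B ∷_) (filterB notEndingInF (pats r s))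
admissible-pats r s = trans (filterB-++ admissible (map (F ∷_) (pats r (suc s))) _) (cong₂ _++_
  (filterB-none (All.map⁺ (All.map (λ {p} → admissible-F {p}) (pats-hasG r s))))
  (trans (filterB-++ admissible (map (G ∷_) (pats (suc r) s)) _) (cong₂ _++_
    (filterB-map-cong (All.universal admissible-G (pats (suc r) s)))
    (filterB-map-cong (All.universal admissible-B (pats r s))))))

notEndingInF-pats : ∀ r s → filterB notEndingInF (pats (suc r) (suc s)) ≡
  map (F ∷_) (filterB notEndingInF (pats r (suc s))) ++
  (map (G ∷_) (filterB notEndingInF (pats (suc r) s)) ++ map (B ∷_) (filterB notEndingInF (pats r s)))
notEndingInF-pats r s = trans (filterB-++ notEndingInF (map (F ∷_) (pats r (suc s))) _) (cong₂ _++_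
  (filterB-map-cong (All.map (λ {p} eq → cong (_∧ notEndingInF p) eq) (pats-hasG r s)))
  (trans (filterB-++ notEndingInF (map (G ∷_) (pats (suc r) s)) _) (cong₂ _++_
    (filterB-map notEndingInF (G ∷_) (pats (suc r) s))
    (filterB-map notEndingInF (B ∷_) (pats r s)))))

notEndingInF-pats-zero : ∀ r → filterB notEndingInF (pats (suc r) zero) ≡ []
notEndingInF-pats-zero r = filterB-none (All.map⁺ (All.map (λ {p} eq → cong (_∧ notEndingInF p) eq) (pats-noG r)))

-- Block form of the inner harmonic product

Z : ℕ → Poly → Poly
Z k p = Y (fold p X (pred k))

linear-X^ : ∀ n → Linear (λ p → fold p X n)
linear-X^ = linear-fold linear-X

linear-Z : ∀ k → Linear (Z k)
linear-Z k = linear-∘ linear-Y (linear-X^ (pred k))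

X^-mon : ∀ n u → fold (mon u) X n ≋ mon (List.replicate n x ++ u)
X^-mon zero u = ≋-refl
X^-mon (suc n) u = ≋-trans (cong-≋ linear-X (X^-mon n u)) (prepend-mon x _)

Z-mon : ∀ k u → Z k (mon u) ≋ mon (z k ++ u)
Z-mon k u = ≋-trans (cong-≋ linear-Y (X^-mon (pred k) u)) (prepend-mon y _)

Z-map : ∀ {A : Set} k (g : A → Word) as → map (λ a → (1ℚ , z k ++ g a)) as ≋ Z k (map (λ a → (1ℚ , g a)) as)
Z-map k g [] = ≋-sym (zero-homo (linear-Z k))
Z-map k g (a ∷ as) = ≋-trans (⊕-cong (≋-sym (Z-mon k (g a))) (Z-map k g as))
  (≋-sym (⊕-homo (linear-Z k) (mon (g a)) _))

-- The harmonic product restricted to the patterns whose last position lies in Im g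
E : List ℕ → List ℕ → Poly
E [] ls = mon (zWord ls)
E (k ∷ ks) [] = zeroP
E (k ∷ ks) (l ∷ ls) = Z k (E ks (l ∷ ls)) ⊕ (Z l (E (k ∷ ks) ls) ⊕ Z (k ℕ.+ l) (E ks ls))

patternSum : List ℕ → List ℕ → List (List Label) → Poly
patternSum ks ls = map (λ p → (1ℚ , zWord (applyPat p ks ls)))

patternSum-++ : ∀ ks ls ps qs → patternSum ks ls (ps ++ qs) ≋ patternSum ks ls ps ⊕ patternSum ks ls qs
patternSum-++ ks ls ps qs = ≋-reflexive (map-++ (λ p → (1ℚ , zWord (applyPat p ks ls))) ps qs)

patternSum-F : ∀ k ks ls ps → patternSum (k ∷ ks) ls (map (F ∷_) ps) ≋ Z k (patternSum ks ls ps)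
patternSum-F k ks ls ps = ≋-trans (≋-reflexive (sym (map-∘ ps))) (Z-map k (λ p → zWord (applyPat p ks ls)) ps)

patternSum-G : ∀ ks l ls ps → patternSum ks (l ∷ ls) (map (G ∷_) ps) ≋ Z l (patternSum ks ls ps)
patternSum-G [] l ls ps = ≋-trans (≋-reflexive (sym (map-∘ ps))) (Z-map l (λ p → zWord (applyPat p [] ls)) ps)
patternSum-G (k ∷ ks) l ls ps = ≋-trans (≋-reflexive (sym (map-∘ ps))) (Z-map l (λ p → zWord (applyPat p (k ∷ ks) ls)) ps)

patternSum-B : ∀ k ks l ls ps → patternSum (k ∷ ks) (l ∷ ls) (map (B ∷_) ps) ≋ Z (k ℕ.+ l) (patternSum ks ls ps)
patternSum-B k ks l ls ps =
  ≋-trans (≋-reflexive (sym (map-∘ ps))) (Z-map (k ℕ.+ l) (λ p → zWord (applyPat p ks ls)) ps)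

patternSum-GB : ∀ k ks l ls gs bs → patternSum (k ∷ ks) (l ∷ ls) (map (G ∷_) gs ++ map (B ∷_) bs) ≋
  Z l (patternSum (k ∷ ks) ls gs) ⊕ Z (k ℕ.+ l) (patternSum ks ls bs)
patternSum-GB k ks l ls gs bs = ≋-trans (patternSum-++ (k ∷ ks) (l ∷ ls) (map (G ∷_) gs) (map (B ∷_) bs))
  (⊕-cong (patternSum-G (k ∷ ks) l ls gs) (patternSum-B k ks l ls bs))

patternSum-E : ∀ ks ls → patternSum ks ls (filterB notEndingInF (pats (lengthN ks) (lengthN ls))) ≋ E ks ls
patternSum-E [] [] = ≋-refl
patternSum-E [] (l ∷ ls) = begin
  patternSum [] (l ∷ ls) (filterB notEndingInF (map (G ∷_) (pats 0 (lengthN ls))))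
    ≡⟨ cong (patternSum [] (l ∷ ls)) (filterB-map notEndingInF (G ∷_) (pats 0 (lengthN ls))) ⟩
  patternSum [] (l ∷ ls) (map (G ∷_) (filterB notEndingInF (pats 0 (lengthN ls))))
    ≈⟨ patternSum-G [] l ls (filterB notEndingInF (pats 0 (lengthN ls))) ⟩
  Z l (patternSum [] ls (filterB notEndingInF (pats 0 (lengthN ls))))
    ≈⟨ cong-≋ (linear-Z l) (patternSum-E [] ls) ⟩
  Z l (mon (zWord ls))
    ≈⟨ Z-mon l (zWord ls) ⟩
  mon (zWord (l ∷ ls)) ∎
patternSum-E (k ∷ ks) [] = ≋-reflexive (cong (patternSum (k ∷ ks) []) (notEndingInF-pats-zero (lengthN ks)))
patternSum-E (k ∷ ks) (l ∷ ls) = begin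
  patternSum (k ∷ ks) (l ∷ ls) (filterB notEndingInF (pats (suc r) (suc s)))
    ≡⟨ cong (patternSum (k ∷ ks) (l ∷ ls)) (notEndingInF-pats r s) ⟩
  patternSum (k ∷ ks) (l ∷ ls) (map (F ∷_) fs ++ (map (G ∷_) gs ++ map (B ∷_) bs))
    ≈⟨ patternSum-++ (k ∷ ks) (l ∷ ls) (map (F ∷_) fs) (map (G ∷_) gs ++ map (B ∷_) bs) ⟩
  patternSum (k ∷ ks) (l ∷ ls) (map (F ∷_) fs) ⊕ patternSum (k ∷ ks) (l ∷ ls) (map (G ∷_) gs ++ map (B ∷_) bs)
    ≈⟨ ⊕-cong (≋-trans (patternSum-F k ks (l ∷ ls) fs) (cong-≋ (linear-Z k) (patternSum-E ks (l ∷ ls))))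
         (≋-trans (patternSum-GB k ks l ls gs bs)
           (⊕-cong (cong-≋ (linear-Z l) (patternSum-E (k ∷ ks) ls)) (cong-≋ (linear-Z (k ℕ.+ l)) (patternSum-E ks ls)))) ⟩
  E (k ∷ ks) (l ∷ ls) ∎
  where
  r = lengthN ks
  s = lengthN ls
  fs = filterB notEndingInF (pats r (suc s))
  gs = filterB notEndingInF (pats (suc r) s)
  bs = filterB notEndingInF (pats r s)

harmZ-∷ : ∀ k ks l ls → harmZ (k ∷ ks) (l ∷ ls) ≋ Z l (E (k ∷ ks) ls) ⊕ Z (k ℕ.+ l) (E ks ls)
harmZ-∷ k ks l ls = begin
  patternSum (k ∷ ks) (l ∷ ls) (filterB admissible (pats (suc r) (suc s)))
    ≡⟨ cong (patternSum (k ∷ ks) (l ∷ ls)) (admissible-pats r s) ⟩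
  patternSum (k ∷ ks) (l ∷ ls) (map (G ∷_) gs ++ map (B ∷_) bs)
    ≈⟨ patternSum-GB k ks l ls gs bs ⟩
  Z l (patternSum (k ∷ ks) ls gs) ⊕ Z (k ℕ.+ l) (patternSum ks ls bs)
    ≈⟨ ⊕-cong (cong-≋ (linear-Z l) (patternSum-E (k ∷ ks) ls)) (cong-≋ (linear-Z (k ℕ.+ l)) (patternSum-E ks ls)) ⟩
  Z l (E (k ∷ ks) ls) ⊕ Z (k ℕ.+ l) (E ks ls) ∎
  where
  r = lengthN ks
  s = lengthN ls
  gs = filterB notEndingInF (pats (suc r) s)
  bs = filterB notEndingInF (pats r s)

-- Sums over compositions

-- The first part is still open and has size `k`; each of the `n` further letters enlarges the
-- current part (`x`) or starts a new one (`y`).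
from : ℕ → ℕ → (List ℕ → Poly) → Poly
from k n φ = lin (λ u → φ (toZgo k u)) (xpy^ n)

-- Σ φ(k₁, …, kᵣ) over the compositions k₁ + ⋯ + kᵣ = n, which are coded by words of length n - 1
compositions : (List ℕ → Poly) → Seq
compositions φ zero = φ []
compositions φ (suc n) = from 1 n φ

from-zero : ∀ k φ → from k 0 φ ≋ φ (k ∷ [])
from-zero k φ = lin-mon (λ u → φ (toZgo k u)) []

from-suc : ∀ k n φ → from k (suc n) φ ≋ from (suc k) n φ ⊕ compositions (λ ks → φ (k ∷ ks)) (suc n)
from-suc k n φ = begin
  lin f (xpy^ (suc n)) ≈⟨ cong-≋ (linear-lin f) (xpy^-suc n) ⟩
  lin f (X (xpy^ n) ⊕ Y (xpy^ n)) ≈⟨ ⊕-homo (linear-lin f) (X (xpy^ n)) (Y (xpy^ n)) ⟩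
  lin f (X (xpy^ n)) ⊕ lin f (Y (xpy^ n)) ≈⟨ ⊕-cong (lin-prepend f x (xpy^ n)) (lin-prepend f y (xpy^ n)) ⟩
  from (suc k) n φ ⊕ compositions (λ ks → φ (k ∷ ks)) (suc n) ∎
  where
  f : Word → Poly
  f u = φ (toZgo k u)

toZgo-∷ : ∀ k u → ∃₂ λ m ms → toZgo k u ≡ m ∷ ms
toZgo-∷ k [] = k , [] , refl
toZgo-∷ k (x ∷ u) = toZgo-∷ (suc k) u
toZgo-∷ k (y ∷ u) = k , toZgo 1 u , refl

from-cong : ∀ k n {φ ψ : List ℕ → Poly} → (∀ m ms → φ (m ∷ ms) ≋ ψ (m ∷ ms)) → from k n φ ≋ from k n ψ
from-cong k n {φ} {ψ} e = lin-cong pointwise (xpy^ n)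
  where
  pointwise : ∀ u → φ (toZgo k u) ≋ ψ (toZgo k u)
  pointwise u with toZgo k u | toZgo-∷ k u
  ... | _ | m , ms , refl = e m ms

from-⊕ : ∀ k n φ ψ → from k n (λ ks → φ ks ⊕ ψ ks) ≋ from k n φ ⊕ from k n ψ
from-⊕ k n φ ψ = lin-⊕ (λ u → φ (toZgo k u)) (λ u → ψ (toZgo k u)) (xpy^ n)

from-natural : ∀ {L} → Linear L → ∀ k n φ → from k n (λ ks → L (φ ks)) ≋ L (from k n φ)
from-natural ℓ k n φ = lin-natural ℓ (λ u → φ (toZgo k u)) (xpy^ n)

-- `toZgo` never returns the empty list, so the default value does not enter the sums.
onCons : (ℕ → List ℕ → Poly) → List ℕ → Poly
onCons h [] = zeroP
onCons h (k ∷ ks) = h k ks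

Q : Seq → Seq
Q = geometric X

-- As the first part grows, the run of x behind the leading y takes the lengths e k, e k + 1, ...,
-- which sum to a geometric series in x. The offset `e` covers a part standing alone and a part
-- merged into a block of the word.
from-Q : (e : ℕ → ℕ) → (∀ k → e (suc k) ≡ suc (e k)) → ∀ (φ θ : List ℕ → Poly) →
  (∀ k ks → φ (suc k ∷ ks) ≋ Y (fold (θ ks) X (e k))) →
  ∀ k n → from (suc k) n φ ≋ Y (fold (Q (compositions θ) n) X (e k))
from-Q e e-suc φ θ φ≋ k zero = ≋-trans (from-zero (suc k) φ) (φ≋ k [])
from-Q e e-suc φ θ φ≋ k (suc n) = begin
  from (suc k) (suc n) φ
    ≈⟨ from-suc (suc k) n φ ⟩
  from (suc (suc k)) n φ ⊕ from 1 n (λ ks → φ (suc k ∷ ks))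
    ≈⟨ ⊕-cong (from-Q e e-suc φ θ φ≋ (suc k) n)
         (≋-trans (from-cong 1 n {λ ks → φ (suc k ∷ ks)} {λ ks → Y (fold (θ ks) X (e k))} (λ m ms → φ≋ k (m ∷ ms))) (from-natural ℓ 1 n θ)) ⟩
  Y (fold q X (e (suc k))) ⊕ Y (fold c X (e k))
    ≡⟨ cong (λ i → Y (fold q X i) ⊕ Y (fold c X (e k))) (e-suc k) ⟩
  Y (X (fold q X (e k))) ⊕ Y (fold c X (e k))
    ≈⟨ ⊕-comm (Y (X (fold q X (e k)))) (Y (fold c X (e k))) ⟩
  Y (fold c X (e k)) ⊕ Y (X (fold q X (e k)))
    ≈⟨ ⊕-congˡ (Y (fold c X (e k))) (cong-≋ linear-Y (fold-comm linear-X q (e k))) ⟨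
  Y (fold c X (e k)) ⊕ Y (fold (X q) X (e k))
    ≈⟨ ⊕-homo ℓ c (X q) ⟨
  Y (fold (c ⊕ X q) X (e k)) ∎
  where
  q = Q (compositions θ) n
  c = compositions θ (suc n)
  ℓ = linear-∘ linear-Y (linear-X^ (e k))

Ê : List ℕ → Seq
Ê ls = compositions (λ ks → E ks ls)

-- A part merged into `z (suc l)` lengthens its run of x by the size of the part, and an unmerged
-- block counts as size 0. All sizes together give (1 - t x)⁻¹.
harmonic-∷ : ∀ l ls n →
  from 1 n (λ ks → Z (suc l) (E ks ls) ⊕ onCons (λ k ks → Z (k ℕ.+ suc l) (E ks ls)) ks) ≋
  Y (fold (Q (Ê ls) (suc n)) X l)
harmonic-∷ l ls n = begin
  from 1 n (λ ks → Z (suc l) (E ks ls) ⊕ onCons h ks)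
    ≈⟨ from-⊕ 1 n (λ ks → Z (suc l) (E ks ls)) (onCons h) ⟩
  from 1 n (λ ks → Z (suc l) (E ks ls)) ⊕ from 1 n (onCons h)
    ≈⟨ ⊕-cong (from-natural (linear-Z (suc l)) 1 n (λ ks → E ks ls))
         (from-Q (ℕ._+ suc l) (λ _ → refl) (onCons h) (λ ks → E ks ls) (λ _ _ → ≋-refl) 0 n) ⟩
  Z (suc l) (Ê ls (suc n)) ⊕ Y (X (fold q X l))
    ≈⟨ ⊕-congˡ (Z (suc l) (Ê ls (suc n))) (cong-≋ linear-Y (fold-comm linear-X q l)) ⟨
  Z (suc l) (Ê ls (suc n)) ⊕ Y (fold (X q) X l)
    ≈⟨ ⊕-homo (linear-Z (suc l)) (Ê ls (suc n)) (X q) ⟨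
  Y (fold (Q (Ê ls) (suc n)) X l) ∎
  where
  h : ℕ → List ℕ → Poly
  h k ks = Z (k ℕ.+ suc l) (E ks ls)
  q = Q (Ê ls) n

Ê-suc : ∀ l ls n → Ê (suc l ∷ ls) (suc n) ≋
  Y (Q (Ê (suc l ∷ ls)) n) ⊕ Y (fold (Q (Ê ls) (suc n)) X l)
Ê-suc l ls n = begin
  from 1 n (λ ks → E ks (suc l ∷ ls))
    ≈⟨ from-cong 1 n {λ ks → E ks (suc l ∷ ls)} {λ ks → onCons g ks ⊕ h ks} (λ m ms → ≋-refl) ⟩
  from 1 n (λ ks → onCons g ks ⊕ h ks)
    ≈⟨ from-⊕ 1 n (onCons g) h ⟩
  from 1 n (onCons g) ⊕ from 1 n h
    ≈⟨ ⊕-cong (from-Q (λ k → k) (λ _ → refl) (onCons g) (λ ks → E ks (suc l ∷ ls)) (λ _ _ → ≋-refl) 0 n)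
         (harmonic-∷ l ls n) ⟩
  Y (Q (Ê (suc l ∷ ls)) n) ⊕ Y (fold (Q (Ê ls) (suc n)) X l) ∎
  where
  g : ℕ → List ℕ → Poly
  g k ks = Z k (E ks (suc l ∷ ls))
  h : List ℕ → Poly
  h ks = Z (suc l) (E ks ls) ⊕ onCons (λ k ks → Z (k ℕ.+ suc l) (E ks ls)) ks

T-x^ : ∀ l w n → T (List.replicate l x ++ w) n ≡ fold (T w n) X l
T-x^ zero w n = refl
T-x^ (suc l) w n = cong X (T-x^ l w n)

-- The bridge from blocks to letters. For q = `Q (Ê (suc l ∷ ls))`, parts placed before the block
-- contribute t y q by `Ê-suc`, and `Q` itself contributes t x q; together they form the t (x + y) q
-- that characterises P.
T-zWord : ∀ {ls} → All (0 <_) ls → ∀ n → T (zWord ls) n ≋ Q (Ê ls) n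
-- `E (k ∷ ks) []` is zero, so `Ê []` is constant and only powers of x remain.
T-zWord [] = geometric-unique linear-X {Ê []} ≋-refl λ n →
  ≋-sym (⊕-congʳ (X (T [] n)) (≋-trans (from-cong 1 n {λ ks → E ks []} {λ _ → zeroP} (λ _ _ → ≋-refl)) (from-natural linear-zero 1 n (λ _ → zeroP))))
T-zWord {suc l ∷ ls} (s≤s z≤n ∷ ls>0) n = ≋-trans
  (geometric-cong linear-S (λ k → cong-≋ linear-Y (≋-trans (≋-reflexive (T-x^ l (zWord ls) k))
    (cong-≋ (linear-X^ l) (T-zWord ls>0 k)))) n)
  (≋-sym (geometric-unique linear-S {λ k → Y (fold (Q (Ê ls) k) X l)} {q} (≋-sym (Z-mon (suc l) (zWord ls))) step n))
  where
  q = Q (Ê (suc l ∷ ls))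
  step : ∀ n → q (suc n) ≋ Y (fold (Q (Ê ls) (suc n)) X l) ⊕ S (q n)
  step n = ≋-trans (⊕-congʳ (X (q n)) (Ê-suc l ls n))
    (additively (Y (q n) ∷ Y (fold (Q (Ê ls) (suc n)) X l) ∷ X (q n) ∷ [])
      (v₀ :+ v₁ :+ v₂) (v₁ :+ (v₂ :+ v₀)) refl)

-- `w` is what follows an initial y, so the first block of y w is `z (suc l)`. Positivity is
-- recorded because `z 0` and `z 1` are the same word.
record Blocks (w : Word) : Set where
  field
    {l} : ℕ
    {ls} : List ℕ
    toZgo-1 : toZgo 1 w ≡ suc l ∷ ls
    word : w ≡ List.replicate l x ++ zWord ls
    positive : All (0 <_) ls

blocks-go : ∀ k w → ∃₂ λ l ls → toZgo (suc k) w ≡ suc (k ℕ.+ l) ∷ ls ×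
  w ≡ List.replicate l x ++ zWord ls × All (0 <_) ls
blocks-go k [] = 0 , [] , cong (λ i → suc i ∷ []) (sym (ℕ.+-identityʳ k)) , refl , []
blocks-go k (x ∷ w) with blocks-go (suc k) w
... | l , ls , eq , w≡ , ls>0 =
  suc l , ls , trans eq (cong (λ i → suc i ∷ ls) (sym (ℕ.+-suc k l))) , cong (x ∷_) w≡ , ls>0
blocks-go k (y ∷ w) with blocks-go 0 w
... | l , ls , eq , w≡ , ls>0 =
  0 , suc l ∷ ls , cong₂ (λ i is → suc i ∷ is) (sym (ℕ.+-identityʳ k)) eq , cong (y ∷_) w≡ , s≤s z≤n ∷ ls>0

blocks : ∀ w → Blocks w
blocks w with blocks-go 0 w
... | l , ls , eq , w≡ , ls>0 = record { toZgo-1 = eq ; word = w≡ ; positive = ls>0 }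

-- The action of {1}⋆ⁿ on words beginning with y

innerHarmW-y : ∀ u w {l ls} → toZgo 1 w ≡ l ∷ ls → innerHarmW (y ∷ u) (y ∷ w) ≡ harmZ (toZgo 1 u) (l ∷ ls)
innerHarmW-y u w eq rewrite eq = refl

T-zero : ∀ w → T w 0 ≋ mon w
T-zero [] = ≋-refl
T-zero (x ∷ w) = ≋-trans (cong-≋ linear-X (T-zero w)) (prepend-mon x w)
T-zero (y ∷ w) = ≋-trans (cong-≋ linear-Y (T-zero w)) (prepend-mon y w)

linear-∗̲ʳ : ∀ p → Linear (p ∗̲_)
linear-∗̲ʳ = linear-bilinʳ innerHarmW

-- In positive degree {1}⋆ⁿ is the sum of all words y u of length n, hence over all compositions of
-- n, to which the block formulas apply.
one⋆-∗̲-mon : ∀ n w → one⋆ n ∗̲ mon (y ∷ w) ≋ Y (T w n)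
one⋆-∗̲-mon zero w = ≋-trans (bilin-mon innerHarmW [] (y ∷ w)) (≋-sym (T-zero (y ∷ w)))
one⋆-∗̲-mon (suc n) w = begin
  one⋆ (suc n) ∗̲ mon (y ∷ w)
    ≈⟨ bilin-monʳ innerHarmW (one⋆ (suc n)) (y ∷ w) ⟩
  lin (λ u → innerHarmW u (y ∷ w)) (one⋆ (suc n))
    ≈⟨ cong-≋ (linear-lin (λ u → innerHarmW u (y ∷ w))) (letter-· y (xpy^ n)) ⟩
  lin (λ u → innerHarmW u (y ∷ w)) (Y (xpy^ n))
    ≈⟨ lin-prepend (λ u → innerHarmW u (y ∷ w)) y (xpy^ n) ⟩
  lin (λ u → innerHarmW (y ∷ u) (y ∷ w)) (xpy^ n)
    ≈⟨ lin-cong (λ u → ≋-reflexive (innerHarmW-y u w toZgo-1)) (xpy^ n) ⟩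
  from 1 n (λ ks → harmZ ks (suc l ∷ ls))
    ≈⟨ from-cong 1 n {λ ks → harmZ ks (suc l ∷ ls)} {λ ks → Z (suc l) (E ks ls) ⊕ onCons (λ k ks → Z (k ℕ.+ suc l) (E ks ls)) ks}
         (λ k ks → harmZ-∷ k ks (suc l) ls) ⟩
  from 1 n (λ ks → Z (suc l) (E ks ls) ⊕ onCons (λ k ks → Z (k ℕ.+ suc l) (E ks ls)) ks)
    ≈⟨ harmonic-∷ l ls n ⟩
  Y (fold (Q (Ê ls) (suc n)) X l)
    ≈⟨ cong-≋ linear-Y (cong-≋ (linear-X^ l) (T-zWord positive (suc n))) ⟨
  Y (fold (T (zWord ls) (suc n)) X l)
    ≡⟨ cong Y (T-x^ l (zWord ls) (suc n)) ⟨
  Y (T (List.replicate l x ++ zWord ls) (suc n))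
    ≡⟨ cong (λ v → Y (T v (suc n))) word ⟨
  Y (T w (suc n)) ∎
  where open Blocks (blocks w)

one⋆-∗̲ : ∀ n p → one⋆ n ∗̲ Y p ≋ Y (Tₗ n p)
one⋆-∗̲ n = linear-ext (linear-∘ (linear-∗̲ʳ (one⋆ n)) linear-Y) (linear-∘ linear-Y (linear-Tₗ n)) λ w → begin
  one⋆ n ∗̲ Y (mon w) ≈⟨ cong-≋ (linear-∗̲ʳ (one⋆ n)) (prepend-mon y w) ⟩
  one⋆ n ∗̲ mon (y ∷ w) ≈⟨ one⋆-∗̲-mon n w ⟩
  Y (T w n) ≈⟨ cong-≋ linear-Y (Tₗ-mon n w) ⟨
  Y (Tₗ n (mon w)) ∎

-- The action of Σₙ (-t)ⁿ yⁿ

ones : ℕ → List ℕ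
ones n = List.replicate n 1

toZgo-yⁿ : ∀ n → toZgo 1 (List.replicate n y) ≡ ones (suc n)
toZgo-yⁿ zero = refl
toZgo-yⁿ (suc n) = cong (1 ∷_) (toZgo-yⁿ n)

e : List ℕ → Seq
e ls n = scale (sgn n) (E (ones n) ls)

-- U = (1 - t x) e as series in t
U : List ℕ → Seq
U ls zero = e ls zero
U ls (suc n) = e ls (suc n) ⊖ X (e ls n)

scale-sgn-suc : ∀ n p → scale (sgn (suc n)) p ≋ scale (- 1ℚ) (scale (sgn n) p)
scale-sgn-suc n p = ≋-trans (≋-reflexive (cong (λ c → scale c p)
  (trans (cong -_ (sym (ℚ.*-identityˡ (sgn n)))) (ℚ.neg-distribˡ-* 1ℚ (sgn n))))) (scale-* (- 1ℚ) (sgn n) p)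

-- Merging a part 1 into the block adds one x and uses up one y, which reverses the sign. This gives
-- the factor 1 - t x, inverse to the one in `harmonic-∷`.
U-harmonic : ∀ l ls n →
  scale (sgn (suc n)) (Z (suc l) (E (ones (suc n)) ls) ⊕ Z (suc (suc l)) (E (ones n) ls)) ≋ Z (suc l) (U ls (suc n))
U-harmonic l ls n = begin
  scale (sgn (suc n)) (Z (suc l) a ⊕ Z (suc (suc l)) b)
    ≈⟨ scale-⊕ (sgn (suc n)) (Z (suc l) a) (Z (suc (suc l)) b) ⟩
  scale (sgn (suc n)) (Z (suc l) a) ⊕ scale (sgn (suc n)) (Z (suc (suc l)) b)
    ≈⟨ ⊕-cong (≋-sym (scale-homo (linear-Z (suc l)) (sgn (suc n)) a))
         (≋-trans (scale-sgn-suc n (Z (suc (suc l)) b)) (scale-cong (- 1ℚ) (≋-trans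
           (≋-sym (scale-homo (linear-Z (suc (suc l))) (sgn n) b))
           (cong-≋ linear-Y (≋-sym (fold-comm linear-X (e ls n) l)))))) ⟩
  Z (suc l) (e ls (suc n)) ⊖ Z (suc l) (X (e ls n))
    ≈⟨ ⊖-homo (linear-Z (suc l)) (e ls (suc n)) (X (e ls n)) ⟨
  Z (suc l) (U ls (suc n)) ∎
  where
  a = E (ones (suc n)) ls
  b = E (ones n) ls

e-zero : ∀ l ls → e (suc l ∷ ls) 0 ≋ Z (suc l) (U ls 0)
e-zero l ls = begin
  scale 1ℚ (mon (zWord (suc l ∷ ls))) ≈⟨ scale-cong 1ℚ (Z-mon (suc l) (zWord ls)) ⟨
  scale 1ℚ (Z (suc l) (mon (zWord ls))) ≈⟨ scale-homo (linear-Z (suc l)) 1ℚ (mon (zWord ls)) ⟨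
  Z (suc l) (scale 1ℚ (mon (zWord ls))) ∎

-- As series, (1 + t y) e = z U: a part 1 placed before the block is a leading y with reversed sign.
e-suc : ∀ l ls n → e (suc l ∷ ls) (suc n) ≋ Z (suc l) (U ls (suc n)) ⊖ Y (e (suc l ∷ ls) n)
e-suc l ls n = begin
  scale (sgn (suc n)) (Y a ⊕ b)
    ≈⟨ scale-⊕ (sgn (suc n)) (Y a) b ⟩
  scale (sgn (suc n)) (Y a) ⊕ scale (sgn (suc n)) b
    ≈⟨ ⊕-cong (≋-trans (scale-sgn-suc n (Y a)) (scale-cong (- 1ℚ) (≋-sym (scale-homo linear-Y (sgn n) a))))
         (U-harmonic l ls n) ⟩
  scale (- 1ℚ) (Y (e (suc l ∷ ls) n)) ⊕ Z (suc l) (U ls (suc n))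
    ≈⟨ ⊕-comm (scale (- 1ℚ) (Y (e (suc l ∷ ls) n))) (Z (suc l) (U ls (suc n))) ⟩
  Z (suc l) (U ls (suc n)) ⊖ Y (e (suc l ∷ ls) n) ∎
  where
  a = E (ones n) (suc l ∷ ls)
  b = Z (suc l) (E (ones (suc n)) ls) ⊕ Z (suc (suc l)) (E (ones n) ls)

yPow-∗̲ : ∀ n w → let open Blocks (blocks w) in
  scale (sgn n) (yPow n ∗̲ mon (y ∷ w)) ≋ Z (suc l) (U ls n)
yPow-∗̲ zero w = begin
  scale 1ℚ (mon [] ∗̲ mon (y ∷ w)) ≈⟨ scale-cong 1ℚ (bilin-mon innerHarmW [] (y ∷ w)) ⟩
  scale 1ℚ (mon (y ∷ w)) ≡⟨ cong (λ v → scale 1ℚ (mon (y ∷ v))) word ⟩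
  scale 1ℚ (mon (zWord (suc l ∷ ls))) ≈⟨ e-zero l ls ⟩
  Z (suc l) (U ls 0) ∎
  where open Blocks (blocks w)
yPow-∗̲ (suc n) w = begin
  scale (sgn (suc n)) (mon (y ∷ List.replicate n y) ∗̲ mon (y ∷ w))
    ≈⟨ scale-cong (sgn (suc n)) (bilin-mon innerHarmW (y ∷ List.replicate n y) (y ∷ w)) ⟩
  scale (sgn (suc n)) (innerHarmW (y ∷ List.replicate n y) (y ∷ w))
    ≡⟨ cong (scale (sgn (suc n))) (trans (innerHarmW-y (List.replicate n y) w toZgo-1)
         (cong (λ ks → harmZ ks (suc l ∷ ls)) (toZgo-yⁿ n))) ⟩
  scale (sgn (suc n)) (harmZ (ones (suc n)) (suc l ∷ ls))
    ≈⟨ scale-cong (sgn (suc n)) (harmZ-∷ 1 (ones n) (suc l) ls) ⟩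
  scale (sgn (suc n)) (Z (suc l) (E (ones (suc n)) ls) ⊕ Z (suc (suc l)) (E (ones n) ls))
    ≈⟨ U-harmonic l ls n ⟩
  Z (suc l) (U ls (suc n)) ∎
  where open Blocks (blocks w)

-- The two actions are mutually inverse

Tₜ : Seq → Seq
Tₜ = convolve Tₗ

Tₜ-cong : ∀ {f g : Seq} → (∀ n → f n ≋ g n) → ∀ n → Tₜ f n ≋ Tₜ g n
Tₜ-cong = convolve-cong linear-Tₗ

Tₜ-X : ∀ f n → Tₜ (λ k → X (f k)) n ≋ X (Tₜ f n)
Tₜ-X f n = ≋-trans (diagonal-cong (λ i j → Tₗ-X i (f j)) n) (diagonal-natural linear-X (λ i j → Tₗ i (f j)) n)

Tₜ-X^ : ∀ l f n → Tₜ (λ k → fold (f k) X l) n ≋ fold (Tₜ f n) X l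
Tₜ-X^ zero f n = ≋-refl
Tₜ-X^ (suc l) f n = ≋-trans (Tₜ-X (λ k → fold (f k) X l) n) (cong-≋ linear-X (Tₜ-X^ l f n))

Tₜ-Y : ∀ f n → Tₜ (λ k → Y (f k)) n ≋ P (λ k → Y (Tₜ f k)) n
Tₜ-Y f n = begin
  diagonal (λ i j → Tₗ i (Y (f j))) n
    ≈⟨ diagonal-cong (λ i j → Tₗ-Y i (f j)) n ⟩
  diagonal (λ i j → P (λ k → Y (Tₗ k (f j))) i) n
    ≈⟨ diagonal-geometric linear-S (λ k j → Y (Tₗ k (f j))) n ⟩
  P (diagonal (λ k j → Y (Tₗ k (f j)))) n
    ≈⟨ geometric-cong linear-S (diagonal-natural linear-Y (λ k j → Tₗ k (f j))) n ⟩
  P (λ k → Y (Tₜ f k)) n ∎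

Tₜ-step-⊖ : ∀ {f g h : Seq} → f 0 ≋ g 0 → (∀ n → f (suc n) ≋ g (suc n) ⊖ h n) →
  ∀ n → Tₜ f (suc n) ≋ Tₜ g (suc n) ⊖ Tₜ h n
Tₜ-step-⊖ {f} {g} {h} e₀ e₊ n = ≋-trans
  (convolve-step linear-Tₗ {f} {g} {λ k → scale (- 1ℚ) (h k)} e₀ e₊ n)
  (⊕-congˡ (Tₜ g (suc n)) (≋-trans (diagonal-cong (λ i j → scale-homo (linear-Tₗ i) (- 1ℚ) (h j)) n)
    (diagonal-natural (linear-scale (- 1ℚ)) (λ i j → Tₗ i (h j)) n)))

Tₜ-U-suc : ∀ ls n → Tₜ (U ls) (suc n) ≋ Tₜ (e ls) (suc n) ⊖ X (Tₜ (e ls) n)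
Tₜ-U-suc ls n = ≋-trans (Tₜ-step-⊖ {U ls} {e ls} {λ k → X (e ls k)} ≋-refl (λ _ → ≋-refl) n)
  (⊕-congˡ (Tₜ (e ls) (suc n)) (scale-cong (- 1ℚ) (Tₜ-X (e ls) n)))

⊖-inverse : ∀ {p q} → p ≋ q → p ⊖ q ≋ zeroP
⊖-inverse {p} {q} eq = ≋-trans (⊕-congʳ (scale (- 1ℚ) q) eq) (additively (q ∷ []) (v₀ :- v₀) :0 refl)

Tₜ-e-[] : ∀ n → Tₜ (e []) n ≋ T [] n
Tₜ-e-[] n = begin
  Tₜ (e []) n ≈⟨ Tₜ-cong e-[] n ⟩
  Tₜ (constant (mon [])) n ≈⟨ convolve-constant linear-Tₗ (mon []) n ⟩
  Tₗ n (mon []) ≈⟨ Tₗ-mon n [] ⟩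
  T [] n ∎
  where
  e-[] : ∀ n → e [] n ≋ constant (mon []) n
  e-[] zero = scale-1 (mon [])
  e-[] (suc n) = ≋-refl

-- Σₙ tⁿ {1}⋆ⁿ and Σₙ (-t)ⁿ yⁿ act as mutually inverse operators. With h the image of e and a the
-- constant series of the word, h = P a - t P y h, and multiplying by 1 - t(x+y) gives (1 - t x) h = a.
Tₜ-U : ∀ {ls} → All (0 <_) ls → ∀ n → Tₜ (U ls) n ≋ constant (mon (zWord ls)) n
Tₜ-U [] zero = Tₜ-e-[] 0
Tₜ-U [] (suc n) = ≋-trans (Tₜ-U-suc [] n)
  (⊖-inverse (≋-trans (Tₜ-e-[] (suc n)) (cong-≋ linear-X (≋-sym (Tₜ-e-[] n)))))
Tₜ-U {suc l ∷ ls} (s≤s z≤n ∷ ls>0) = conclusion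
  where
  a h : Seq
  a = constant (mon (zWord (suc l ∷ ls)))
  h = Tₜ (e (suc l ∷ ls))
  b : Seq
  b = P (λ k → Y (h k))

  Z-constant : ∀ n → Z (suc l) (constant (mon (zWord ls)) n) ≋ a n
  Z-constant zero = Z-mon (suc l) (zWord ls)
  Z-constant (suc n) = zero-homo (linear-Z (suc l))

  Tₜ-Z-U : ∀ n → Tₜ (λ k → Z (suc l) (U ls k)) n ≋ P a n
  Tₜ-Z-U n = ≋-trans (Tₜ-Y (λ k → fold (U ls k) X l) n)
    (geometric-cong linear-S (λ k → ≋-trans (cong-≋ linear-Y (≋-trans (Tₜ-X^ l (U ls) k)
      (cong-≋ (linear-X^ l) (Tₜ-U ls>0 k)))) (Z-constant k)) n)

  h-zero : h 0 ≋ a 0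
  h-zero = ≋-trans (cong-≋ (linear-Tₗ 0) (e-zero l ls)) (Tₜ-Z-U 0)

  h-suc : ∀ n → h (suc n) ≋ P a (suc n) ⊖ b n
  h-suc n = ≋-trans (Tₜ-step-⊖ {e (suc l ∷ ls)} {λ k → Z (suc l) (U ls k)} {λ k → Y (e (suc l ∷ ls) k)} (e-zero l ls) (e-suc l ls) n)
    (⊕-cong (Tₜ-Z-U (suc n)) (scale-cong (- 1ℚ) (Tₜ-Y (e (suc l ∷ ls)) n)))

  S-P : ∀ n → S (P a n) ⊖ b n ≋ X (h n)
  S-P zero = begin
    S (a 0) ⊖ Y (h 0) ≈⟨ ⊕-congʳ (scale (- 1ℚ) (Y (h 0))) (cong-≋ linear-S h-zero) ⟨
    X (h 0) ⊕ Y (h 0) ⊖ Y (h 0) ≈⟨ additively (X (h 0) ∷ Y (h 0) ∷ []) (v₀ :+ v₁ :- v₁) v₀ refl ⟩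
    X (h 0) ∎
  S-P (suc n) = begin
    S (P a (suc n)) ⊖ (Y (h (suc n)) ⊕ S (b n))
      ≈⟨ additively (S (P a (suc n)) ∷ Y (h (suc n)) ∷ S (b n) ∷ []) (v₀ :- (v₁ :+ v₂)) (v₀ :- v₂ :- v₁) refl ⟩
    S (P a (suc n)) ⊖ S (b n) ⊖ Y (h (suc n))
      ≈⟨ ⊕-congʳ (scale (- 1ℚ) (Y (h (suc n)))) (≋-trans (cong-≋ linear-S (h-suc n)) (⊖-homo linear-S (P a (suc n)) (b n))) ⟨
    X (h (suc n)) ⊕ Y (h (suc n)) ⊖ Y (h (suc n))
      ≈⟨ additively (X (h (suc n)) ∷ Y (h (suc n)) ∷ []) (v₀ :+ v₁ :- v₁) v₀ refl ⟩
    X (h (suc n)) ∎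

  conclusion : ∀ n → Tₜ (U (suc l ∷ ls)) n ≋ a n
  conclusion zero = h-zero
  -- `P a (suc n)` computes to `S (P a n)`, because `a` vanishes in positive degree.
  conclusion (suc n) = ≋-trans (Tₜ-U-suc (suc l ∷ ls) n) (⊖-inverse (≋-trans (h-suc n) (S-P n)))

-- The generating series of F

linear-⧢̲ʳ : ∀ p → Linear (p ⧢̲_)
linear-⧢̲ʳ = linear-bilinʳ innerShW

linear-Fv : ∀ n → Linear (λ v → Fv v n)
linear-Fv n = linear-⊖ (linear-∘ (linear-∗̲ʳ (one⋆ n)) (linear-⧢̲ʳ (mon (y ∷ []))))
  (linear-∘ (linear-scale (ℕ→ℚ (suc n))) (linear-∗̲ʳ (one⋆ (suc n))))

-- The extra term of `T-insertions` is what ∂ₜ produces, up to sign, on the initial y that was split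
-- off; adding `Y p` to both sides lets the two cancel.
Fv-mon : ∀ w n → Fv (mon (y ∷ w)) n ≋ ∂ₜ (λ k → Y (T w k)) n
Fv-mon w n = ⊕-cancelʳ (Y p) (begin
  Fv (mon (y ∷ w)) n ⊕ Y p
    ≈⟨ ⊕-congʳ (Y p) (⊕-cong
         (≋-trans (cong-≋ (linear-∗̲ʳ (one⋆ n)) (≋-trans (bilin-mon innerShW (y ∷ []) (y ∷ w)) (innerShW-y w)))
           (one⋆-∗̲ n (insertions w)))
         (scale-cong (- 1ℚ) (≋-trans (scale-cong (ℕ→ℚ (suc n)) (one⋆-∗̲-mon (suc n) w))
           (≋-sym (scale-homo linear-Y (ℕ→ℚ (suc n)) (T w (suc n))))))) ⟩
  Y c ⊖ Y d ⊕ Y p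
    ≈⟨ additively (Y c ∷ Y d ∷ Y p ∷ []) (v₀ :- v₁ :+ v₂) (v₀ :+ v₂ :- v₁) refl ⟩
  Y c ⊕ Y p ⊖ Y d
    ≈⟨ ⊕-congʳ (scale (- 1ℚ) (Y d)) (≋-trans (≋-sym (⊕-homo linear-Y c p))
         (≋-trans (cong-≋ linear-Y (T-insertions w n)) (⊕-homo linear-Y d (∂ₜ (T w) n)))) ⟩
  Y d ⊕ Y (∂ₜ (T w) n) ⊖ Y d
    ≈⟨ additively (Y d ∷ Y (∂ₜ (T w) n) ∷ []) (v₀ :+ v₁ :- v₀) v₁ refl ⟩
  Y (∂ₜ (T w) n)
    ≈⟨ ∂ₜ-Y (T w) n ⟨
  ∂ₜ (λ k → Y (T w k)) n ⊕ Y p ∎)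
  where
  p = P (λ k → X (T w k)) n
  c = Tₗ n (insertions w)
  d = derivative (T w) n

linear-diagonal : ∀ {L : ℕ → ℕ → Poly → Poly} → (∀ i j → Linear (L i j)) → ∀ n → Linear (λ p → diagonal (λ i j → L i j p) n)
linear-diagonal ℓ zero = ℓ 0 0
linear-diagonal ℓ (suc n) = linear-⊕ (ℓ 0 (suc n)) (linear-diagonal (λ i → ℓ (suc i)) n)

Fv-Y : ∀ n p → Fv (Y p) n ≋ ∂ₜ (λ k → Y (Tₗ k p)) n
Fv-Y n = linear-ext (linear-∘ (linear-Fv n) linear-Y)
  (linear-diagonal (λ i j → linear-∘ (linear-∂⁺ i) (linear-∘ linear-Y (linear-Tₗ j))) n) λ w → begin
    Fv (Y (mon w)) n ≈⟨ cong-≋ (linear-Fv n) (prepend-mon y w) ⟩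
    Fv (mon (y ∷ w)) n ≈⟨ Fv-mon w n ⟩
    ∂ₜ (λ k → Y (T w k)) n ≈⟨ convolve-cong linear-∂⁺ (λ k → cong-≋ linear-Y (Tₗ-mon k w)) n ⟨
    ∂ₜ (λ k → Y (Tₗ k (mon w))) n ∎

-- The alternating sum as a Cauchy product

sumP-cong : ∀ m {f g : ℕ → Poly} → (∀ i → i ≤ m → f i ≋ g i) → sumP m f ≋ sumP m g
sumP-cong zero eq = ≋-refl
sumP-cong (suc m) eq = ⊕-cong (sumP-cong m (λ i i≤m → eq i (ℕ.m≤n⇒m≤1+n i≤m))) (eq (suc m) ℕ.≤-refl)

sumP-diagonal : ∀ m (Γ : ℕ → ℕ → Poly) → sumP (suc m) (λ i → Γ (suc m ∸ i) (pred i)) ≋ diagonal Γ m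
sumP-diagonal zero Γ = ≋-refl
sumP-diagonal (suc m) Γ = begin
  sumP (suc m) (λ i → Γ (suc (suc m) ∸ i) (pred i)) ⊕ Γ (m ∸ m) (suc m)
    ≈⟨ ⊕-cong (≋-trans (sumP-cong (suc m) (λ i i≤m → ≋-reflexive (cong (λ j → Γ j (pred i)) (ℕ.+-∸-assoc 1 i≤m))))
         (sumP-diagonal m (λ i → Γ (suc i)))) (≋-reflexive (cong (λ j → Γ j (suc m)) (ℕ.n∸n≡0 m))) ⟩
  diagonal (λ i → Γ (suc i)) m ⊕ Γ 0 (suc m)
    ≈⟨ ⊕-comm (diagonal (λ i → Γ (suc i)) m) (Γ 0 (suc m)) ⟩
  diagonal Γ (suc m) ∎

linear-sumP : ∀ {L : ℕ → Poly → Poly} → (∀ i → Linear (L i)) → ∀ m → Linear (λ p → sumP m (λ i → L i p))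
linear-sumP ℓ zero = linear-zero
linear-sumP ℓ (suc m) = linear-⊕ (linear-sumP ℓ m) (ℓ (suc m))

linear-LHS : ∀ m → Linear (LHS m)
linear-LHS m = linear-sumP (λ i → linear-∘ (linear-scale (sgn (pred i)))
  (linear-∘ (linear-Fv (m ∸ i)) (linear-∗̲ʳ (yPow (pred i))))) m

LHS-mon : ∀ m w → LHS (suc m) (mon (y ∷ w)) ≋ ∂⁺ m (mon (y ∷ w))
LHS-mon m w = begin
  LHS (suc m) (mon (y ∷ w))
    ≈⟨ sumP-diagonal m (λ n j → scale (sgn j) (Fv (yPow j ∗̲ mon (y ∷ w)) n)) ⟩
  diagonal (λ n j → scale (sgn j) (Fv (yPow j ∗̲ mon (y ∷ w)) n)) m
    ≈⟨ diagonal-cong (λ n j → ≋-trans (≋-sym (scale-homo (linear-Fv n) (sgn j) (yPow j ∗̲ mon (y ∷ w))))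
         (≋-trans (cong-≋ (linear-Fv n) (yPow-∗̲ j w)) (Fv-Y n (V j)))) m ⟩
  convolve (λ n p → ∂ₜ (λ k → Y (Tₗ k p)) n) V m
    ≈⟨ convolve-assoc linear-∂⁺ (λ k p → Y (Tₗ k p)) V m ⟩
  ∂ₜ (convolve (λ k p → Y (Tₗ k p)) V) m
    ≈⟨ convolve-cong linear-∂⁺ inverse m ⟩
  ∂ₜ (constant (mon (y ∷ w))) m
    ≈⟨ convolve-constant linear-∂⁺ (mon (y ∷ w)) m ⟩
  ∂⁺ m (mon (y ∷ w)) ∎
  where
  open Blocks (blocks w)
  -- By `yPow-∗̲`, this is the signed product of yʲ with the word, its initial y split off.
  V : Seq
  V j = fold (U ls j) X l
  Z-constant : ∀ n → Z (suc l) (constant (mon (zWord ls)) n) ≋ constant (mon (y ∷ w)) n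
  Z-constant zero = ≋-trans (Z-mon (suc l) (zWord ls)) (≋-reflexive (cong (λ v → mon (y ∷ v)) (sym word)))
  Z-constant (suc n) = zero-homo (linear-Z (suc l))
  inverse : ∀ n → convolve (λ k p → Y (Tₗ k p)) V n ≋ constant (mon (y ∷ w)) n
  inverse n = begin
    convolve (λ k p → Y (Tₗ k p)) V n ≈⟨ diagonal-natural linear-Y (λ k j → Tₗ k (V j)) n ⟩
    Y (Tₜ V n) ≈⟨ cong-≋ linear-Y (≋-trans (Tₜ-X^ l (U ls) n) (cong-≋ (linear-X^ l) (Tₜ-U positive n))) ⟩
    Z (suc l) (constant (mon (zWord ls)) n) ≈⟨ Z-constant n ⟩
    constant (mon (y ∷ w)) n ∎

-- Reduction to words beginning with y

keepY : Word → Poly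
keepY [] = zeroP
keepY (x ∷ u) = zeroP
keepY (y ∷ u) = mon (y ∷ u)

coeff-keepY-y : ∀ p v → coeff (lin keepY p) (y ∷ v) ≡ coeff p (y ∷ v)
coeff-keepY-y [] v = refl
coeff-keepY-y ((a , []) ∷ p) v = coeff-keepY-y p v
coeff-keepY-y ((a , x ∷ u) ∷ p) v = coeff-keepY-y p v
coeff-keepY-y ((a , y ∷ u) ∷ p) v with (y ∷ u) ≟W (y ∷ v)
... | yes _ = cong₂ _+_ (ℚ.*-identityʳ a) (coeff-keepY-y p v)
... | no _ = coeff-keepY-y p v

coeff-keepY-[] : ∀ p → coeff (lin keepY p) [] ≡ 0ℚ
coeff-keepY-[] [] = refl
coeff-keepY-[] ((a , []) ∷ p) = coeff-keepY-[] p
coeff-keepY-[] ((a , x ∷ u) ∷ p) = coeff-keepY-[] p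
coeff-keepY-[] ((a , y ∷ u) ∷ p) = coeff-keepY-[] p

coeff-keepY-x : ∀ p v → coeff (lin keepY p) (x ∷ v) ≡ 0ℚ
coeff-keepY-x [] v = refl
coeff-keepY-x ((a , []) ∷ p) v = coeff-keepY-x p v
coeff-keepY-x ((a , x ∷ u) ∷ p) v = coeff-keepY-x p v
coeff-keepY-x ((a , y ∷ u) ∷ p) v = coeff-keepY-x p v

-- `InHC0` constrains coefficients, not the listed words: entries outside y𝔥x may occur and cancel.
-- The projection discards the entries that do not begin with y, whose coefficients vanish, so that
-- the argument can proceed word by word.
keepY-InHC0 : ∀ w → InHC0 w → lin keepY w ≋ w
keepY-InHC0 w w∈ = mk≋ coefficients
  where
  vanishes : ∀ u → (∀ v → u ≢ y ∷ v) → 0ℚ ≡ coeff w u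
  vanishes u u≢y with coeff w u ℚ.≟ 0ℚ
  ... | yes c≡0 = sym c≡0
  ... | no c≢0 with w∈ u c≢0
  ... | v , u≡ = contradiction u≡ (u≢y _)
  coefficients : lin keepY w ≈ w
  coefficients [] = trans (coeff-keepY-[] w) (vanishes [] λ _ ())
  coefficients (x ∷ v) = trans (coeff-keepY-x w v) (vanishes (x ∷ v) λ _ ())
  coefficients (y ∷ v) = coeff-keepY-y w v

LHS-keepY : ∀ m u → LHS (suc m) (keepY u) ≋ ∂⁺ m (keepY u)
LHS-keepY m [] = zero-homo (linear-LHS (suc m))
LHS-keepY m (x ∷ u) = zero-homo (linear-LHS (suc m))
LHS-keepY m (y ∷ u) = LHS-mon m u

theorem5p5 : (w : Poly) → InHC0 w → (m : ℕ) → m ≥ 1 →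
    LHS m w ≈ ∂ m w
theorem5p5 w w∈ (suc m) (s≤s z≤n) = at (begin
  LHS (suc m) w ≈⟨ cong-≋ (linear-LHS (suc m)) (keepY-InHC0 w w∈) ⟨
  LHS (suc m) (lin keepY w) ≈⟨ lin-natural (linear-LHS (suc m)) keepY w ⟨
  lin (λ u → LHS (suc m) (keepY u)) w ≈⟨ lin-cong (LHS-keepY m) w ⟩
  lin (λ u → ∂⁺ m (keepY u)) w ≈⟨ lin-natural (linear-∂⁺ m) keepY w ⟩
  ∂⁺ m (lin keepY w) ≈⟨ cong-≋ (linear-∂⁺ m) (keepY-InHC0 w w∈) ⟩
  ∂ (suc m) w ∎)
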